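{- There exists a constant $\varepsilon>0$ such that every finite graph $G$ with maximum average degree less than $\frac{11}{3}$ is weighted $\varepsilon$-flexibly $4$-choosable.
   Context: All graphs are finite and simple. The maximum average degree $\mathrm{mad}(G)$ is the maximum of $2|E(H)|/|V(H)|$ over all nonempty subgraphs $H\subseteq G$. A list assignment on $G$ is a map $L$ assigning to each vertex $v$ a set $L(v)\subseteq\mathbb N$; it is a $k$-assignment if $|L(v)|=k$ for all $v$. An $L$-coloring is a proper coloring $\phi$ of $G$ with $\phi(v)\in L(v)$ for all $v$. A weighted request on $G$ with list assignment $L$ is a function $w$ assigning a nonnegative real number $w(v,c)$ to each pair $(v,c)$ with $v\in V(G)$, $c\in L(v)$. $G$ is weighted $\varepsilon$-flexibly $k$-choosable if for every $k$-assignment $L$ and every weighted request $w$ on $G$ there is an $L$-coloring $\phi$ of $G$ with $\sum_{v\in V(G)} w(v,\phi(v)) \ge \varepsilon \sum_{v\in V(G)}\sum_{c\in L(v)} w(v,c)$.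
   Formalization: The weights w(v,c) of the request are nonnegative rational numbers instead of nonnegative real numbers (the constant ε is also obtained as a rational number, which loses nothing). -}

module Defs where

open import Data.Bool using (Bool; true; false; if_then_else_)
open import Data.Nat using (ℕ; zero; suc; _+_; _*_; _<_)
open import Data.Fin using (Fin)
open import Data.List using (List; map; foldr)
open import Data.List.Base using (allFin)
open import Data.Vec using (Vec; lookup)
open import Data.Product using (_×_)
open import Data.Rational using (ℚ; 0ℚ) renaming (_+_ to _+ℚ_)
open import Relation.Binary.PropositionalEquality using (_≡_; _≢_)

record Graph (n : ℕ) : Set where
  field
    adj    : Fin n → Fin n → Bool
    sym    : ∀ u v → adj u v ≡ adj v u
    irrefl : ∀ v → adj v v ≡ false
open Graph public

record Subgraph {n : ℕ} (G : Graph n) : Set where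
  field
    vs    : Fin n → Bool
    es    : Fin n → Fin n → Bool
    esSym : ∀ u v → es u v ≡ es v u
    esSub : ∀ u v → es u v ≡ true → (adj G u v ≡ true) × (vs u ≡ true) × (vs v ≡ true)
open Subgraph public

Σℕ : (n : ℕ) → (Fin n → ℕ) → ℕ
Σℕ n f = foldr _+_ 0 (map f (allFin n))

Σℚ : (n : ℕ) → (Fin n → ℚ) → ℚ
Σℚ n f = foldr _+ℚ_ 0ℚ (map f (allFin n))

b2n : Bool → ℕ
b2n true  = 1
b2n false = 0

numV : {n : ℕ} {G : Graph n} → Subgraph G → ℕ
numV {n} H = Σℕ n (λ v → b2n (vs H v))

twiceE : {n : ℕ} {G : Graph n} → Subgraph G → ℕ
twiceE {n} H = Σℕ n (λ u → Σℕ n (λ v → b2n (es H u v)))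

-- mad(G) < 11/3 : every nonempty subgraph H has 2|E(H)|/|V(H)| < 11/3
MadLt11/3 : {n : ℕ} → Graph n → Set
MadLt11/3 G = ∀ (H : Subgraph G) → 0 < numV H → 3 * twiceE H < 11 * numV H

IsKAssignment : {n k : ℕ} → (Fin n → Vec ℕ k) → Set
IsKAssignment {n} {k} L = ∀ (v : Fin n) (i j : Fin k) → lookup (L v) i ≡ lookup (L v) j → i ≡ j

-- An L-coloring, given by choosing for each v a position φ v in L v; colour = lookup (L v) (φ v).
IsProperLColoring : {n k : ℕ} → Graph n → (Fin n → Vec ℕ k) → (Fin n → Fin k) → Set
IsProperLColoring G L φ = ∀ u v → adj G u v ≡ true → lookup (L u) (φ u) ≢ lookup (L v) (φ v)

-- w v i = w(v, c) where c = lookup (L v) i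
totalWeight : {n k : ℕ} → (Fin n → Fin k → ℚ) → ℚ
totalWeight {n} {k} w = Σℚ n (λ v → Σℚ k (λ i → w v i))

gainedWeight : {n k : ℕ} → (Fin n → Fin k → ℚ) → (Fin n → Fin k) → ℚ
gainedWeight {n} w φ = Σℚ n (λ v → w v (φ v))

{-# OPTIONS --safe #-}
module Submission where

-- For every vertex set S we build a multiset of L-colourings of G[S] in which, for constants K₁, K₂, K₃,
--   every vertex u avoids every colour c in a fraction 1/K₁ of the colourings,
--   every demanded pair u, v avoids c simultaneously in a fraction 1/K₂ of them,
--   every vertex takes every colour of its list in a fraction 1/K₃ of them;
-- averaging the gained weight over the multiset for S = V(G) then gives the theorem.  A pair is demanded
-- if it is the neighbourhood in S of some vertex w outside S: such a w was removed earlier and will need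
-- both of its neighbours to avoid the colour requested at w.
--
-- S is reduced by removing at most five vertices H ⊆ S, each with at most two neighbours in S ∖ H.  Each
-- colouring of S ∖ H is extended by all assignments to H (improper ones replaced by a fixed proper
-- extension), so an extension that exists has probability at least 4⁻⁵.  Only the demanded pairs have to
-- be controlled jointly, which makes the following configurations reducible:
--   a vertex of degree at most 2;  an undemanded edge between 3-vertices;  a path of three 3-vertices;
--   a 4-vertex with two spokes forming an undemanded pair, a 4-vertex with three spokes, a 5-vertex with
--   four spokes (a spoke of x is an adjacent 3-vertex s with {x, s} undemanded);
--   two adjacent 3-vertices that are spokes of two common 4-vertices.
--
-- One of them always occurs.  The average degree bound for S together with the vertices outside S having
-- exactly two neighbours in S reads 3 Σ deg + #demands < 11 |S|.  If no configuration occurs, let every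
-- vertex of degree at least 5 send 1 to each of its spokes, every 4-vertex divide 1 among its at most two
-- spokes, and every demand divide 1 among the 3-vertices of its pair.  Then each 3-vertex receives its
-- deficit 2 and no vertex sends more than its surplus 3 deg − 11, a contradiction.

open import Defs
open import Data.Nat using (ℕ)
open import Data.Fin using (Fin)
open import Data.Vec using (Vec)
open import Data.Product using (Σ; ∃; _×_)
import Algebra.Bundles
import Data.Bool as Bool
import Data.List.Membership.DecPropositional as DecMembership
import Data.List.Relation.Unary.All as All
import Data.List.Relation.Unary.Any as Any
import Data.List.Relation.Unary.Any.Properties as Any
import Data.List.Relation.Unary.Unique.Propositional.Properties as Unique
import Data.Nat as ℕ
import Data.Nat.Properties as ℕ
import Data.Rational as ℚ
import Data.Rational.Properties as ℚ
open import Data.Bool using (Bool; true; false; if_then_else_; _∧_; _∨_; not)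
open import Data.Bool.Properties using (∧-comm; ∨-comm)
open import Data.Fin using (zero; suc)
open import Data.Fin.Properties using (_≟_; any?; all?)
open import Data.List using (List; []; _∷_; [_]; _++_; map; foldr; length; filter; allFin; concatMap; take)
open import Data.List.Membership.Propositional using (_∈_; _∉_; lose)
open import Data.List.Membership.Propositional.Properties using (∈-∃++; ∈-++⁺ˡ; ∈-++⁺ʳ; ∈-++⁻; ∈-map⁺; ∈-map⁻; ∈-filter⁺; ∈-filter⁻; ∈-allFin)
open import Data.List.Properties using (length-++; length-map; length-take)
open import Data.List.Relation.Binary.Subset.Propositional using (_⊆_)
open import Data.List.Relation.Unary.All using ([]; _∷_)
open import Data.List.Relation.Unary.AllPairs using (AllPairs; []; _∷_)
open import Data.List.Relation.Unary.Any using (Any; here; there)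
open import Data.List.Relation.Unary.Unique.Propositional using (Unique)
open import Data.Nat using (zero; suc; z≤n; s≤s)
open import Data.Product using (_,_; proj₁; proj₂)
open import Data.Sum using (_⊎_; inj₁; inj₂)
open import Data.Vec using (lookup)
open import Function using (_∘_)
open import Relation.Binary.PropositionalEquality using (_≡_; _≢_; _≗_; refl; trans; cong; cong₂; subst; subst₂; ≢-sym) renaming (sym to ≡-sym)
open import Relation.Nullary using (Dec; does; yes; no; ¬_; contradiction)
open import Relation.Nullary.Decidable using (¬?; _×-dec_; _⊎-dec_; _→-dec_; map′; ⌊_⌋; dec-true; dec-false; decidable-stable)
open import Relation.Unary using (Pred; Decidable)

module _ where

  open import Data.Nat using (_+_; _*_; _^_; _≤_; _<_; _≤?_)
  open import Data.Nat.Properties hiding (_≟_; _≤?_)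
  open import Data.Nat.Solver using (module +-*-Solver)
  open import Algebra.Properties.CommutativeSemigroup +-commutativeSemigroup using (interchange; x∙yz≈y∙xz)

  -- Finite sums of natural numbers over lists.

  module _ {A : Set} where

    ∑ : (A → ℕ) → List A → ℕ
    ∑ f xs = foldr _+_ 0 (map f xs)

    ∑-mono : ∀ {f g : A → ℕ} xs → (∀ x → f x ≤ g x) → ∑ f xs ≤ ∑ g xs
    ∑-mono []       f≤g = z≤n
    ∑-mono (x ∷ xs) f≤g = +-mono-≤ (f≤g x) (∑-mono xs f≤g)

    ∑-cong : ∀ {f g : A → ℕ} xs → (∀ x → f x ≡ g x) → ∑ f xs ≡ ∑ g xs
    ∑-cong []       f≡g = refl
    ∑-cong (x ∷ xs) f≡g = cong₂ _+_ (f≡g x) (∑-cong xs f≡g)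

    ∑-+ : ∀ (f g : A → ℕ) xs → ∑ (λ x → f x + g x) xs ≡ ∑ f xs + ∑ g xs
    ∑-+ f g []       = refl
    ∑-+ f g (x ∷ xs) =
      trans (cong (f x + g x +_) (∑-+ f g xs)) (interchange (f x) (g x) (∑ f xs) (∑ g xs))

    ∑-*ˡ : ∀ k (f : A → ℕ) xs → ∑ (λ x → k * f x) xs ≡ k * ∑ f xs
    ∑-*ˡ k f []       = ≡-sym (*-zeroʳ k)
    ∑-*ˡ k f (x ∷ xs) = trans (cong (k * f x +_) (∑-*ˡ k f xs)) (≡-sym (*-distribˡ-+ k (f x) _))

    ∑-0 : ∀ (xs : List A) → ∑ (λ _ → 0) xs ≡ 0
    ∑-0 []       = refl
    ∑-0 (x ∷ xs) = ∑-0 xs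

    ∑-++ : ∀ (f : A → ℕ) xs ys → ∑ f (xs ++ ys) ≡ ∑ f xs + ∑ f ys
    ∑-++ f []       ys = refl
    ∑-++ f (x ∷ xs) ys = trans (cong (f x +_) (∑-++ f xs ys)) (≡-sym (+-assoc (f x) _ _))

    ∑-const : ∀ k (xs : List A) → ∑ (λ _ → k) xs ≡ length xs * k
    ∑-const k []       = refl
    ∑-const k (x ∷ xs) = cong (k +_) (∑-const k xs)

    ∑-filter : ∀ {p} {P : Pred A p} (P? : Decidable P) (f : A → ℕ) xs →
               ∑ (λ x → b2n (does (P? x)) * f x) xs ≡ ∑ f (filter P? xs)
    ∑-filter P? f []       = refl
    ∑-filter P? f (x ∷ xs) with does (P? x)
    ... | true  = cong₂ _+_ (+-identityʳ (f x)) (∑-filter P? f xs)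
    ... | false = ∑-filter P? f xs

    -- Each element of `xs` is cut out of `ys` where it occurs; uniqueness keeps the remaining
    -- elements of `xs` inside what is left.
    ∑-⊆ : ∀ (f : A → ℕ) {xs ys} → Unique xs → xs ⊆ ys → ∑ f xs ≤ ∑ f ys
    ∑-⊆ f {[]}     []        xs⊆ys = z≤n
    ∑-⊆ f {x ∷ xs} (x∉ ∷ un) xs⊆ys with ∈-∃++ (xs⊆ys (here refl))
    ... | as , bs , refl = begin
      f x + ∑ f xs          ≤⟨ +-monoʳ-≤ (f x) (∑-⊆ f un rest) ⟩
      f x + ∑ f (as ++ bs)  ≡⟨ cong (f x +_) (∑-++ f as bs) ⟩
      f x + (∑ f as + ∑ f bs) ≡⟨ x∙yz≈y∙xz (f x) (∑ f as) (∑ f bs) ⟩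
      ∑ f as + (f x + ∑ f bs) ≡⟨ ∑-++ f as (x ∷ bs) ⟨
      ∑ f (as ++ x ∷ bs)    ∎
      where
      open ≤-Reasoning
      rest : xs ⊆ as ++ bs
      rest {z} z∈xs with ∈-++⁻ as (xs⊆ys (there z∈xs))
      ... | inj₁ z∈as          = ∈-++⁺ˡ z∈as
      ... | inj₂ (here refl)   = contradiction refl (All.lookup x∉ z∈xs)
      ... | inj₂ (there z∈bs)  = ∈-++⁺ʳ as z∈bs

    length-⊆ : ∀ {xs ys : List A} → Unique xs → xs ⊆ ys → length xs ≤ length ys
    length-⊆ {xs} {ys} un xs⊆ys = begin
      length xs      ≡⟨ *-identityʳ _ ⟨
      length xs * 1  ≡⟨ ∑-const 1 xs ⟨
      ∑ (λ _ → 1) xs ≤⟨ ∑-⊆ (λ _ → 1) un xs⊆ys ⟩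
      ∑ (λ _ → 1) ys ≡⟨ ∑-const 1 ys ⟩
      length ys * 1  ≡⟨ *-identityʳ _ ⟩
      length ys      ∎
      where open ≤-Reasoning

  ∑-swap : ∀ {A B : Set} (f : A → B → ℕ) xs ys →
           ∑ (λ x → ∑ (f x) ys) xs ≡ ∑ (λ y → ∑ (λ x → f x y) xs) ys
  ∑-swap f []       ys = ≡-sym (∑-0 ys)
  ∑-swap f (x ∷ xs) ys =
    trans (cong (∑ (f x) ys +_) (∑-swap f xs ys)) (≡-sym (∑-+ (f x) (λ y → ∑ (λ x → f x y) xs) ys))

  ∑-concatMap : ∀ {A B : Set} (f : B → ℕ) (g : A → List B) xs → ∑ f (concatMap g xs) ≡ ∑ (λ x → ∑ f (g x)) xs
  ∑-concatMap f g []       = refl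
  ∑-concatMap f g (x ∷ xs) = trans (∑-++ f (g x) (concatMap g xs)) (cong (∑ f (g x) +_) (∑-concatMap f g xs))

  ∑-map : ∀ {A B : Set} (f : B → ℕ) (g : A → B) xs → ∑ f (map g xs) ≡ ∑ (f ∘ g) xs
  ∑-map f g []       = refl
  ∑-map f g (x ∷ xs) = cong (f (g x) +_) (∑-map f g xs)

  length-concatMap : ∀ {A B : Set} (g : A → List B) {k} xs → (∀ x → length (g x) ≡ k) → length (concatMap g xs) ≡ length xs * k
  length-concatMap g []       len = refl
  length-concatMap g (x ∷ xs) len = trans (length-++ (g x)) (cong₂ _+_ (len x) (length-concatMap g xs len))

  -- Frequencies of events in multisets.

  count : ∀ {A : Set} → (A → Bool) → List A → ℕ
  count p = ∑ (b2n ∘ p)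

  count-any : ∀ {A : Set} {p : A → Bool} {xs} → Any (λ x → p x ≡ true) xs → 1 ≤ count p xs
  count-any {xs = x ∷ xs} (here px)  = ≤-trans (≤-reflexive (cong b2n (≡-sym px))) (m≤m+n _ _)
  count-any {xs = x ∷ xs} (there px) = ≤-trans (count-any px) (m≤n+m _ _)

  count-all : ∀ {A : Set} {p : A → Bool} xs → (∀ x → p x ≡ true) → count p xs ≡ length xs
  count-all {p = p} xs all = trans (∑-cong xs (λ x → cong b2n (all x))) (trans (∑-const 1 xs) (*-identityʳ _))

  -- The division-free form of "probability at least 1/`K`" for the uniform distribution on the
  -- multiset `xs`. It is trivial for empty `xs`, hence the separate field `inhabited` of
  -- `Flexible`.
  record Frequent {A : Set} (K : ℕ) (p : A → Bool) (xs : List A) : Set where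
    constructor frequent
    field length≤ : length xs ≤ K * count p xs

  open Frequent public

  frequent-mono : ∀ {A : Set} {K K′} {p : A → Bool} {xs} → K ≤ K′ → Frequent K p xs → Frequent K′ p xs
  frequent-mono {p = p} {xs} K≤K′ (frequent len≤) = frequent (≤-trans len≤ (*-monoˡ-≤ (count p xs) K≤K′))

  frequent-always : ∀ {A : Set} (xs : List A) → Frequent 1 (λ _ → true) xs
  frequent-always xs = frequent (≤-reflexive (≡-sym (trans (+-identityʳ _) (count-all xs (λ _ → refl)))))

  module _ {A B : Set} (g : A → List B) {k} (len : ∀ x → length (g x) ≡ k) {p : A → Bool} {q : B → Bool} where

    -- All blocks `g x` have the same size `k`, so passing to blocks does not change the weight of
    -- the good `x`, and within a good block a fraction m/k satisfies `q`. The conclusion is the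
    -- product of the fractions m/k and 1/K, multiplied out; m = 1 gives `frequent-hit` and m = k
    -- gives `frequent-keep`.
    frequent-bind : ∀ {K} m xs → Frequent K p xs → (∀ x → p x ≡ true → m ≤ count q (g x)) →
                    m * length (concatMap g xs) ≤ k * (K * count q (concatMap g xs))
    frequent-bind {K} m xs freq hits = begin
      m * length (concatMap g xs)           ≡⟨ cong (m *_) (length-concatMap g xs len) ⟩
      m * (length xs * k)                   ≤⟨ *-monoʳ-≤ m (*-monoˡ-≤ k (length≤ freq)) ⟩
      m * (K * count p xs * k)              ≡⟨ solve 4 (λ m K c k → m :* (K :* c :* k) := k :* (K :* (m :* c))) refl m K (count p xs) k ⟩
      k * (K * (m * count p xs))            ≡⟨ cong (λ c → k * (K * c)) (∑-*ˡ m (b2n ∘ p) xs) ⟨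
      k * (K * ∑ (λ x → m * b2n (p x)) xs)  ≤⟨ *-monoʳ-≤ k (*-monoʳ-≤ K (∑-mono xs (λ x → hit x (p x) refl))) ⟩
      k * (K * ∑ (λ x → count q (g x)) xs)  ≡⟨ cong (λ c → k * (K * c)) (∑-concatMap (b2n ∘ q) g xs) ⟨
      k * (K * count q (concatMap g xs))    ∎
      where
      open ≤-Reasoning
      open +-*-Solver
      hit : ∀ x b → p x ≡ b → m * b2n b ≤ count q (g x)
      hit x true  px = ≤-trans (≤-reflexive (*-identityʳ m)) (hits x px)
      hit x false _  = ≤-trans (≤-reflexive (*-zeroʳ m)) z≤n

    frequent-hit : ∀ {K N} xs → k ≤ N → Frequent K p xs → (∀ x → p x ≡ true → 1 ≤ count q (g x)) →
                   Frequent (N * K) q (concatMap g xs)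
    frequent-hit {K} {N} xs k≤N freq hits = frequent (begin
      length (concatMap g xs)                ≡⟨ *-identityˡ _ ⟨
      1 * length (concatMap g xs)            ≤⟨ frequent-bind 1 xs freq hits ⟩
      k * (K * count q (concatMap g xs))     ≤⟨ *-monoˡ-≤ (K * count q (concatMap g xs)) k≤N ⟩
      N * (K * count q (concatMap g xs))     ≡⟨ *-assoc N K _ ⟨
      N * K * count q (concatMap g xs)       ∎)
      where open ≤-Reasoning

    frequent-keep : ∀ {K} xs → 1 ≤ k → Frequent K p xs → (∀ x → p x ≡ true → k ≤ count q (g x)) →
                    Frequent K q (concatMap g xs)
    frequent-keep {K} xs (s≤s z≤n) freq hits = frequent (*-cancelˡ-≤ k (frequent-bind k xs freq hits))

  -- Vertex sets and the removal of listed vertices.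

  module _ {n : ℕ} where

    open DecMembership (_≟_ {n}) public using (_∈?_)

    VertexSet : Set
    VertexSet = Fin n → Bool

    infix 4 _∈ˢ_
    _∈ˢ_ : Fin n → VertexSet → Set
    v ∈ˢ S = S v ≡ true

    _∈ˢ?_ : ∀ v S → Dec (v ∈ˢ S)
    v ∈ˢ? S = S v Bool.≟ true

    infixl 6 _∖_
    _∖_ : VertexSet → List (Fin n) → VertexSet
    (S ∖ U) v = S v ∧ not ⌊ v ∈? U ⌋

    ∖-intro : ∀ {S U v} → v ∈ˢ S → v ∉ U → v ∈ˢ S ∖ U
    ∖-intro {S} {U} {v} v∈S v∉U rewrite v∈S with v ∈? U
    ... | yes v∈U = contradiction v∈U v∉U
    ... | no _    = refl

    ∖-elim : ∀ {S U v} → v ∈ˢ S ∖ U → v ∈ˢ S × v ∉ U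
    ∖-elim {S} {U} {v} e with S v | v ∈? U
    ... | true | no v∉U = refl , v∉U

    ∖-removed : ∀ S {U v} → v ∈ U → (S ∖ U) v ≡ false
    ∖-removed S {U} {v} v∈U with S v | v ∈? U
    ... | false | _      = refl
    ... | true  | yes _  = refl
    ... | true  | no v∉U = contradiction v∈U v∉U

    ∖-mono : ∀ {S U U′ v} → U ⊆ U′ → v ∈ˢ S ∖ U′ → v ∈ˢ S ∖ U
    ∖-mono {S} {U} {U′} U⊆U′ v∈ with ∖-elim {S} {U′} v∈
    ... | v∈S , v∉U′ = ∖-intro {S} {U} v∈S (v∉U′ ∘ U⊆U′)

    ∖-cons : ∀ {S U h v} → v ∈ˢ S ∖ U → v ≢ h → v ∈ˢ S ∖ (h ∷ U)
    ∖-cons {S} v∈ v≢h with ∖-elim {S} v∈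
    ... | v∈S , v∉U = ∖-intro {S} v∈S (λ { (here v≡h) → v≢h v≡h ; (there v∈U) → v∉U v∈U })

  ∑-support : ∀ {n} (f : Fin n → ℕ) ys → (∀ {v} → v ∉ ys → f v ≡ 0) → ∑ f (allFin n) ≤ ∑ f ys
  ∑-support {n} f ys vanishes = begin
    ∑ f (allFin n)                                       ≡⟨ ∑-cong (allFin n) split ⟩
    ∑ (λ v → b2n (does (v ∈? ys)) * f v) (allFin n)      ≡⟨ ∑-filter (_∈? ys) f (allFin n) ⟩
    ∑ f (filter (_∈? ys) (allFin n))
      ≤⟨ ∑-⊆ f (Unique.filter⁺ (_∈? ys) (Unique.allFin⁺ n)) (λ v∈ → proj₂ (∈-filter⁻ (_∈? ys) {xs = allFin n} v∈)) ⟩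
    ∑ f ys                                               ∎
    where
    open ≤-Reasoning
    split : ∀ v → f v ≡ b2n (does (v ∈? ys)) * f v
    split v with v ∈? ys
    ... | yes _  = ≡-sym (+-identityʳ (f v))
    ... | no v∉  = vanishes v∉

  ∑-≥ : ∀ {n} (f : Fin n → ℕ) {ys} → Unique ys → ∑ f ys ≤ ∑ f (allFin n)
  ∑-≥ f un = ∑-⊆ f un (λ {v} _ → ∈-allFin v)

  term≤∑ : ∀ {n} (f : Fin n → ℕ) v → f v ≤ ∑ f (allFin n)
  term≤∑ f v = ≤-trans (m≤m+n (f v) 0) (∑-≥ f {v ∷ []} ([] ∷ []))

  module _ {n : ℕ} where

    without : Fin n → List (Fin n) → List (Fin n)
    without u = filter (λ v → ¬? (v ≟ u))

    ∈-without : ∀ {u v xs} → v ∈ xs → v ≢ u → v ∈ without u xs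
    ∈-without {u} v∈ v≢u = ∈-filter⁺ (λ v → ¬? (v ≟ u)) v∈ v≢u

    without-∈ : ∀ {u v} xs → v ∈ without u xs → v ∈ xs × v ≢ u
    without-∈ {u} xs v∈ = ∈-filter⁻ (λ v → ¬? (v ≟ u)) {xs = xs} v∈

    ⊆-without : ∀ u xs → xs ⊆ u ∷ without u xs
    ⊆-without u xs {v} v∈ with v ≟ u
    ... | yes v≡u = here v≡u
    ... | no v≢u  = there (∈-without v∈ v≢u)

    without-unique : ∀ {u xs} → Unique xs → Unique (without u xs)
    without-unique {u} = Unique.filter⁺ (λ v → ¬? (v ≟ u))

    length-without : ∀ u {xs} → Unique xs → length xs ≤ suc (length (without u xs))
    length-without u {xs} un = length-⊆ un (⊆-without u xs)

    -- An element of `ys` missing from `xs` could be put in front of `xs`, giving a duplicate-free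
    -- list inside `ys` that is too long.
    exhausts : ∀ {xs ys : List (Fin n)} → Unique xs → xs ⊆ ys → length ys ≤ length xs → ys ⊆ xs
    exhausts {xs} {ys} un xs⊆ys short {z} z∈ys = decidable-stable (z ∈? xs) λ z∉xs →
      contradiction (length-⊆ {xs = z ∷ xs} (All.tabulate (λ { w∈ refl → z∉xs w∈ }) ∷ un)
                       (λ { (here refl) → z∈ys ; (there w∈) → xs⊆ys w∈ }))
                    (<⇒≱ (s≤s short))

    unique₂ : ∀ {x y : Fin n} → x ≢ y → Unique (x ∷ y ∷ [])
    unique₂ x≢y = (x≢y ∷ []) ∷ [] ∷ []

    unique₃ : ∀ {x y z : Fin n} → x ≢ y → x ≢ z → y ≢ z → Unique (x ∷ y ∷ z ∷ [])
    unique₃ x≢y x≢z y≢z = (x≢y ∷ x≢z ∷ []) ∷ unique₂ y≢z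

  -- Neighbourhoods, degrees and demanded pairs.

  module _ {n : ℕ} (G : Graph n) where

    Adj : Fin n → Fin n → Set
    Adj u v = adj G u v ≡ true

    Adj-sym : ∀ {u v} → Adj u v → Adj v u
    Adj-sym {u} {v} e = trans (sym G v u) e

    Adj⇒≢ : ∀ {u v} → Adj u v → u ≢ v
    Adj⇒≢ {u} e refl with trans (≡-sym e) (irrefl G u)
    ... | ()

    nbrs : VertexSet → Fin n → List (Fin n)
    nbrs S v = filter (λ u → (u ∈ˢ? S) ×-dec (adj G v u Bool.≟ true)) (allFin n)

    nbrs-intro : ∀ {S v u} → u ∈ˢ S → Adj v u → u ∈ nbrs S v
    nbrs-intro {S} {v} {u} u∈S e = ∈-filter⁺ (λ u → (u ∈ˢ? S) ×-dec (adj G v u Bool.≟ true)) (∈-allFin u) (u∈S , e)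

    nbrs-elim : ∀ {S v u} → u ∈ nbrs S v → u ∈ˢ S × Adj v u
    nbrs-elim {S} {v} u∈ = proj₂ (∈-filter⁻ (λ u → (u ∈ˢ? S) ×-dec (adj G v u Bool.≟ true)) {xs = allFin n} u∈)

    nbrs-unique : ∀ S v → Unique (nbrs S v)
    nbrs-unique S v = Unique.filter⁺ (λ u → (u ∈ˢ? S) ×-dec (adj G v u Bool.≟ true)) (Unique.allFin⁺ n)

    nbrs-mono : ∀ {S R v} → (∀ {u} → u ∈ˢ R → u ∈ˢ S) → nbrs R v ⊆ nbrs S v
    nbrs-mono {S} {R} R⊆S u∈ with nbrs-elim {R} u∈
    ... | u∈R , e = nbrs-intro {S} (R⊆S u∈R) e

    deg : VertexSet → Fin n → ℕ
    deg S v = length (nbrs S v)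

    deg-mono : ∀ {S R v} → (∀ {u} → u ∈ˢ R → u ∈ˢ S) → deg R v ≤ deg S v
    deg-mono {S} {R} {v} R⊆S = length-⊆ (nbrs-unique R v) (nbrs-mono {S} {R} R⊆S)

    -- The neighbours in `P` are removed with `U`, so they are disjoint from the surviving
    -- neighbourhood, and both lie in the old one.
    deg-∖ : ∀ {S U h} P → Unique P → P ⊆ U → P ⊆ nbrs S h → deg (S ∖ U) h + length P ≤ deg S h
    deg-∖ {S} {U} {h} P un P⊆U P⊆nbrs = begin
      deg (S ∖ U) h + length P        ≡⟨ length-++ (nbrs (S ∖ U) h) ⟨
      length (nbrs (S ∖ U) h ++ P)    ≤⟨ length-⊆ (Unique.++⁺ (nbrs-unique (S ∖ U) h) un disjoint) included ⟩
      deg S h                         ∎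
      where
      open ≤-Reasoning
      disjoint : ∀ {u} → ¬ (u ∈ nbrs (S ∖ U) h × u ∈ P)
      disjoint (u∈ , u∈P) = proj₂ (∖-elim {S = S} (proj₁ (nbrs-elim {S ∖ U} u∈))) (P⊆U u∈P)
      included : nbrs (S ∖ U) h ++ P ⊆ nbrs S h
      included u∈ with ∈-++⁻ (nbrs (S ∖ U) h) u∈
      ... | inj₁ u∈′ = nbrs-mono {S} {S ∖ U} (λ v∈ → proj₁ (∖-elim {S = S} {U} v∈)) u∈′
      ... | inj₂ u∈P = P⊆nbrs u∈P

    -- The vertex w is coloured after S, and it can take a colour c only if u and v both avoid c.
    Demanded : VertexSet → Fin n → Fin n → Set
    Demanded S u v = ∃ λ w → S w ≡ false × deg S w ≡ 2 × u ≢ v × u ∈ nbrs S w × v ∈ nbrs S w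

    Demanded? : ∀ S u v → Dec (Demanded S u v)
    Demanded? S u v = any? λ w → (S w Bool.≟ false) ×-dec (deg S w ℕ.≟ 2) ×-dec ¬? (u ≟ v)
                                 ×-dec (u ∈? nbrs S w) ×-dec (v ∈? nbrs S w)

    Demanded-sym : ∀ {S u v} → Demanded S u v → Demanded S v u
    Demanded-sym (w , w∉S , d2 , u≢v , u∈ , v∈) = w , w∉S , d2 , ≢-sym u≢v , v∈ , u∈

    members : VertexSet → List (Fin n)
    members S = filter (_∈ˢ? S) (allFin n)

    members-intro : ∀ {S v} → v ∈ˢ S → v ∈ members S
    members-intro {S} {v} v∈S = ∈-filter⁺ (_∈ˢ? S) (∈-allFin v) v∈S

    members-elim : ∀ {S v} → v ∈ members S → v ∈ˢ S
    members-elim {S} v∈ = proj₂ (∈-filter⁻ (_∈ˢ? S) {xs = allFin n} v∈)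

    members-unique : ∀ S → Unique (members S)
    members-unique S = Unique.filter⁺ (_∈ˢ? S) (Unique.allFin⁺ n)

    Degree : VertexSet → ℕ → Fin n → Set
    Degree S d v = v ∈ˢ S × deg S v ≡ d

    Degree? : ∀ S d v → Dec (Degree S d v)
    Degree? S d v = (v ∈ˢ? S) ×-dec (deg S v ℕ.≟ d)

    -- The average degree bound, strengthened by the demands.

    module _ (S : VertexSet {n}) where

      outer : Fin n → Bool
      outer w = not (S w) ∧ does (deg S w ℕ.≟ 2)

      private
        -- Edges between two outer vertices are left out; an outer vertex keeps only its two edges
        -- into `S`.
        joins : Bool → Bool → Bool → Bool → Bool
        joins a b d d′ = (a ∧ b) ∨ ((a ∧ d′) ∨ (d ∧ b))

        -- An outer vertex contributes 1 vertex and 2 edges, so each demand strengthens the degree bound on S by 1.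
        H : Subgraph G
        H = record
          { vs    = λ v → S v ∨ outer v
          ; es    = λ u v → adj G u v ∧ joins (S u) (S v) (outer u) (outer v)
          ; esSym = λ u v → cong₂ _∧_ (sym G u v) (cong₂ _∨_ (∧-comm (S u) (S v))
                      (trans (∨-comm (S u ∧ outer v) (outer u ∧ S v)) (cong₂ _∨_ (∧-comm (outer u) (S v)) (∧-comm (S u) (outer v)))))
          ; esSub = λ u v → ends (adj G u v) (S u) (S v) (outer u) (outer v)
          }
          where
          ends : ∀ e a b d d′ → e ∧ joins a b d d′ ≡ true → e ≡ true × a ∨ d ≡ true × b ∨ d′ ≡ true
          ends true true  true  d    d′   _ = refl , refl , refl
          ends true true  false d    true _ = refl , refl , refl
          ends true true  false true false ()
          ends true true  false false false ()
          ends true false true  true d′   _ = refl , refl , refl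

        arc : Fin n → Fin n → ℕ
        arc u v = b2n (S v ∧ adj G u v)

        ∑-arc : ∀ u → ∑ (arc u) (allFin n) ≡ deg S u
        ∑-arc u = begin-equality
          ∑ (arc u) (allFin n)
            ≡⟨ ∑-cong (allFin n) (λ v → trans (cong b2n (≡-sym (does-true (S v) (adj G u v)))) (≡-sym (*-identityʳ _))) ⟩
          ∑ (λ v → b2n (does ((v ∈ˢ? S) ×-dec (adj G u v Bool.≟ true))) * 1) (allFin n)
            ≡⟨ ∑-filter (λ v → (v ∈ˢ? S) ×-dec (adj G u v Bool.≟ true)) (λ _ → 1) (allFin n) ⟩
          ∑ (λ _ → 1) (nbrs S u)  ≡⟨ ∑-const 1 (nbrs S u) ⟩
          deg S u * 1             ≡⟨ *-identityʳ _ ⟩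
          deg S u                 ∎
          where
          open ≤-Reasoning
          does-true : ∀ a b → does ((a Bool.≟ true) ×-dec (b Bool.≟ true)) ≡ a ∧ b
          does-true true  true  = refl
          does-true true  false = refl
          does-true false true  = refl
          does-true false false = refl

        -- The first product stands for an edge inside `S`, the other two for an edge between `S`
        -- and an outer vertex seen from either end. Outer vertices lie outside `S`, so at most one
        -- product is nonzero.
        edge-count : ∀ u v → b2n (S u) * arc u v + b2n (outer u) * arc u v + b2n (outer v) * arc v u ≤ b2n (es H u v)
        edge-count u v rewrite sym G v u = cases (S u) (S v) (adj G u v) (does (deg S u ℕ.≟ 2)) (does (deg S v ℕ.≟ 2))
          where
          cases : ∀ a b e d d′ → b2n a * b2n (b ∧ e) + b2n (not a ∧ d) * b2n (b ∧ e) + b2n (not b ∧ d′) * b2n (a ∧ e)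
                  ≤ b2n (e ∧ joins a b (not a ∧ d) (not b ∧ d′))
          cases true  true  true  d     d′    = ≤-refl
          cases true  true  false d     d′    = ≤-refl
          cases true  false true  d     true  = ≤-refl
          cases true  false true  d     false = ≤-refl
          cases true  false false d     true  = ≤-refl
          cases true  false false d     false = ≤-refl
          cases false true  true  true  d′    = ≤-refl
          cases false true  true  false d′    = ≤-refl
          cases false true  false true  d′    = ≤-refl
          cases false true  false false d′    = ≤-refl
          cases false false true  true  true  = ≤-refl
          cases false false true  true  false = ≤-refl
          cases false false true  false true  = ≤-refl
          cases false false true  false false = ≤-refl
          cases false false false true  true  = ≤-refl
          cases false false false true  false = ≤-refl
          cases false false false false true  = ≤-refl
          cases false false false false false = ≤-refl

        degrees : ℕ
        degrees = ∑ (λ u → b2n (S u) * deg S u) (allFin n)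

        outer-arcs : ∀ u → ∑ (λ v → b2n (outer u) * arc u v) (allFin n) ≡ b2n (outer u) * 2
        outer-arcs u = trans (∑-*ˡ (b2n (outer u)) (arc u) (allFin n))
                            (trans (cong (b2n (outer u) *_) (∑-arc u)) (two (S u) (deg S u)))
          where
          two : ∀ s d → b2n (not s ∧ does (d ℕ.≟ 2)) * d ≡ b2n (not s ∧ does (d ℕ.≟ 2)) * 2
          two true  d                   = refl
          two false 0                   = refl
          two false 1                   = refl
          two false 2                   = refl
          two false (suc (suc (suc d))) = refl

        outer-total : ∑ (λ u → ∑ (λ v → b2n (outer u) * arc u v) (allFin n)) (allFin n) ≡ 2 * ∑ (b2n ∘ outer) (allFin n)
        outer-total = trans (∑-cong (allFin n) (λ u → trans (outer-arcs u) (*-comm (b2n (outer u)) 2))) (∑-*ˡ 2 (b2n ∘ outer) (allFin n))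

        -- Each outer vertex has exactly two edges into `S`, and `twiceE` counts each of them once
        -- from either end.
        twiceE-bound : degrees + 2 * ∑ (b2n ∘ outer) (allFin n) + 2 * ∑ (b2n ∘ outer) (allFin n) ≤ twiceE H
        twiceE-bound = begin
          degrees + 2 * W + 2 * W
            ≡⟨ cong₂ _+_ (cong₂ _+_ inner (≡-sym outer-total)) (≡-sym (trans (∑-swap (λ u v → b2n (outer v) * arc v u) V V) outer-total)) ⟩
          ∑ (λ u → ∑ (λ v → b2n (S u) * arc u v) V) V + ∑ (λ u → ∑ (λ v → b2n (outer u) * arc u v) V) V
            + ∑ (λ u → ∑ (λ v → b2n (outer v) * arc v u) V) V
            ≡⟨ cong (_+ ∑ (λ u → ∑ (λ v → b2n (outer v) * arc v u) V) V)
                 (≡-sym (∑-+ (λ u → ∑ (λ v → b2n (S u) * arc u v) V) (λ u → ∑ (λ v → b2n (outer u) * arc u v) V) V)) ⟩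
          ∑ (λ u → ∑ (λ v → b2n (S u) * arc u v) V + ∑ (λ v → b2n (outer u) * arc u v) V) V
            + ∑ (λ u → ∑ (λ v → b2n (outer v) * arc v u) V) V
            ≡⟨ ≡-sym (∑-+ (λ u → ∑ (λ v → b2n (S u) * arc u v) V + ∑ (λ v → b2n (outer u) * arc u v) V)
                          (λ u → ∑ (λ v → b2n (outer v) * arc v u) V) V) ⟩
          ∑ (λ u → ∑ (λ v → b2n (S u) * arc u v) V + ∑ (λ v → b2n (outer u) * arc u v) V
            + ∑ (λ v → b2n (outer v) * arc v u) V) V
            ≡⟨ ∑-cong V (λ u → trans (cong (_+ ∑ (λ v → b2n (outer v) * arc v u) V)
                 (≡-sym (∑-+ (λ v → b2n (S u) * arc u v) (λ v → b2n (outer u) * arc u v) V)))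
                 (≡-sym (∑-+ (λ v → b2n (S u) * arc u v + b2n (outer u) * arc u v) (λ v → b2n (outer v) * arc v u) V))) ⟩
          ∑ (λ u → ∑ (λ v → b2n (S u) * arc u v + b2n (outer u) * arc u v + b2n (outer v) * arc v u) V) V
            ≤⟨ ∑-mono V (λ u → ∑-mono V (λ v → edge-count u v)) ⟩
          twiceE H ∎
          where
          open ≤-Reasoning
          V = allFin n
          W = ∑ (b2n ∘ outer) V
          inner : degrees ≡ ∑ (λ u → ∑ (λ v → b2n (S u) * arc u v) V) V
          inner = ∑-cong V (λ u → ≡-sym (trans (∑-*ˡ (b2n (S u)) (arc u) V) (cong (b2n (S u) *_) (∑-arc u))))

        numV-bound : numV H ≤ ∑ (b2n ∘ S) (allFin n) + ∑ (b2n ∘ outer) (allFin n)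
        numV-bound = ≤-trans (∑-mono (allFin n) (λ v → union (S v) (outer v)))
                             (≤-reflexive (∑-+ (b2n ∘ S) (b2n ∘ outer) (allFin n)))
          where
          union : ∀ a b → b2n (a ∨ b) ≤ b2n a + b2n b
          union true  b = s≤s z≤n
          union false b = ≤-refl

      -- With D the degree sum inside `S` and W the number of outer vertices, the hypothesis on `H`
      -- gives 3 (D + 4 W) < 11 (|S| + W), and 12 W - 11 W leaves one W. The vertex `v` makes `H`
      -- nonempty.
      sparse : MadLt11/3 G → ∀ {v} → v ∈ˢ S →
               3 * ∑ (λ u → b2n (S u) * deg S u) (allFin n) + ∑ (b2n ∘ outer) (allFin n) < 11 * ∑ (b2n ∘ S) (allFin n)
      sparse mad {v} v∈S = +-cancelʳ-< (11 * W) _ _ (begin-strict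
        3 * degrees + W + 11 * W              ≡⟨ solve 2 (λ d w → con 3 :* d :+ w :+ con 11 :* w := con 3 :* (d :+ con 2 :* w :+ con 2 :* w)) refl degrees W ⟩
        3 * (degrees + 2 * W + 2 * W)         ≤⟨ *-monoʳ-≤ 3 twiceE-bound ⟩
        3 * twiceE H                          <⟨ mad H (≤-trans (≤-reflexive (cong b2n {true} (≡-sym (cong (_∨ outer v) v∈S)))) (term≤∑ (λ v → b2n (vs H v)) v)) ⟩
        11 * numV H                           ≤⟨ *-monoʳ-≤ 11 numV-bound ⟩
        11 * (∑ (b2n ∘ S) (allFin n) + W)     ≡⟨ *-distribˡ-+ 11 (∑ (b2n ∘ S) (allFin n)) W ⟩
        11 * ∑ (b2n ∘ S) (allFin n) + 11 * W  ∎)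
        where
        open ≤-Reasoning
        open +-*-Solver
        W = ∑ (b2n ∘ outer) (allFin n)

    -- Discharging when no configuration occurs.

    module _ (S : VertexSet {n}) where

      Spoke : Fin n → Fin n → Set
      Spoke x s = (x ∈ˢ S × 4 ≤ deg S x) × Degree S 3 s × Adj x s × ¬ Demanded S x s

      Spoke? : ∀ x s → Dec (Spoke x s)
      Spoke? x s = ((x ∈ˢ? S) ×-dec (4 ≤? deg S x)) ×-dec Degree? S 3 s ×-dec (adj G x s Bool.≟ true) ×-dec ¬? (Demanded? S x s)

      spokes : Fin n → List (Fin n)
      spokes x = filter (Spoke? x) (allFin n)

      spokes-unique : ∀ x → Unique (spokes x)
      spokes-unique x = Unique.filter⁺ (Spoke? x) (Unique.allFin⁺ n)

      spokes-elim : ∀ {x s} → s ∈ spokes x → Spoke x s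
      spokes-elim {x} s∈ = proj₂ (∈-filter⁻ (Spoke? x) {xs = allFin n} s∈)

      record Irreducible : Set where
        field
          low     : ∀ {v} → v ∈ˢ S → 3 ≤ deg S v
          edge    : ∀ {a b} → Degree S 3 a → Degree S 3 b → Adj a b → Demanded S a b
          path    : ∀ {u v w} → Degree S 3 u → Degree S 3 v → Degree S 3 w → Adj v u → Adj v w → u ≡ w
          fork    : ∀ {x s t} → deg S x ≡ 4 → Spoke x s → Spoke x t → s ≢ t → Demanded S s t
          spokes₄ : ∀ {x} → deg S x ≡ 4 → length (spokes x) ≤ 2
          spokes₅ : ∀ {x} → deg S x ≡ 5 → length (spokes x) ≤ 3
          -- The conclusion contradicts `Spoke x a`, so this field says that the configuration is
          -- absent.
          diamond : ∀ {a b x y} → Adj a b → x ≢ y → deg S x ≡ 4 → deg S y ≡ 4 →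
                    Spoke x a → Spoke x b → Spoke y a → Spoke y b → Demanded S x a

      module _ (irr : Irreducible) where

        open Irreducible irr

        private
          V = allFin n

          one-or-two : ∀ b → 1 ≤ (if b then 1 else 2) × (if b then 1 else 2) ≤ 2
          one-or-two true  = s≤s z≤n , s≤s z≤n
          one-or-two false = s≤s z≤n , ≤-refl

          -- A 4-vertex can spare only one unit, so a second spoke halves the share of `s`; larger
          -- vertices never split.
          Split : Fin n → Fin n → Set
          Split x s = deg S x ≡ 4 × ∃ λ t → Spoke x t × t ≢ s

          split? : ∀ x s → Dec (Split x s)
          split? x s = (deg S x ℕ.≟ 4) ×-dec any? (λ t → Spoke? x t ×-dec ¬? (t ≟ s))

          -- All amounts are in half units.
          share : Fin n → Fin n → ℕ
          share x s = if does (split? x s) then 1 else 2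

          give : Fin n → Fin n → ℕ
          give x s = b2n (does (Spoke? x s)) * share x s

          Link : Fin n → Fin n → Fin n → Set
          Link w s v = (S w ≡ false × deg S w ≡ 2) × Degree S 3 s × s ≢ v × s ∈ nbrs S w × v ∈ nbrs S w

          Link? : ∀ w s v → Dec (Link w s v)
          Link? w s v = ((S w Bool.≟ false) ×-dec (deg S w ℕ.≟ 2)) ×-dec Degree? S 3 s
                        ×-dec ¬? (s ≟ v) ×-dec (s ∈? nbrs S w) ×-dec (v ∈? nbrs S w)

          -- What a demand pays to one end depends on the other end `v`: if `v` is a 3-vertex too,
          -- the two half units are shared.
          worth : Fin n → ℕ
          worth v = if does (Degree? S 3 v) then 1 else 2

          pay : Fin n → Fin n → Fin n → ℕ
          pay w s v = b2n (does (Link? w s v)) * worth v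

          -- The income of `s` is filed under a vertex `v`: the gift of `v` together with the
          -- demands on the pair `s`, `v`. Distinct `v` give separate contributions, so a lower
          -- bound on the total only needs a duplicate-free list of such vertices.
          receive : Fin n → Fin n → ℕ
          receive s v = give v s + ∑ (λ w → pay w s v) V

          share≤2 : ∀ x s → share x s ≤ 2
          share≤2 x s = proj₂ (one-or-two (does (split? x s)))

          give-total : ∀ x → ∑ (give x) V ≡ ∑ (share x) (spokes x)
          give-total x = ∑-filter (Spoke? x) (share x) V

          share-total : ∀ x ss → ∑ (share x) ss ≤ length ss * 2
          share-total x ss = ≤-trans (∑-mono ss (share≤2 x)) (≤-reflexive (∑-const 2 ss))

          -- There are at most two spokes. If there are two, each witnesses `Split` for the other,
          -- so each gets one half unit.
          give₄ : ∀ {x} → deg S x ≡ 4 → ∑ (give x) V ≤ 2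
          give₄ {x} d₄ = ≤-trans (≤-reflexive (give-total x)) (bound (spokes x) (spokes₄ d₄) (spokes-unique x) spokes-elim)
            where
            shared : ∀ {s t} → Spoke x t → t ≢ s → share x s ≡ 1
            shared {s} {t} spoke t≢s = cong (λ b → if b then 1 else 2) (dec-true (split? x s) (d₄ , t , spoke , t≢s))
            bound : ∀ ss → length ss ≤ 2 → Unique ss → (∀ {s} → s ∈ ss → Spoke x s) → ∑ (share x) ss ≤ 2
            bound []               _ _ _ = z≤n
            bound (s ∷ [])         _ _ _ = share-total x (s ∷ [])
            bound (s ∷ t ∷ [])     _ ((s≢t ∷ []) ∷ _) spoke =
              ≤-reflexive (cong₂ _+_ (shared (spoke (there (here refl))) (≢-sym s≢t)) (cong (_+ 0) (shared (spoke (here refl)) s≢t)))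
            bound (s ∷ t ∷ r ∷ ss) (s≤s (s≤s ())) _ _

          give-spokes : ∀ x → ∑ (give x) V ≤ length (spokes x) * 2
          give-spokes x = ≤-trans (≤-reflexive (give-total x)) (share-total x (spokes x))

          no-spokes : ∀ {x} → (∀ {s} → ¬ Spoke x s) → ∑ (give x) V ≡ 0
          no-spokes {x} none = trans (give-total x) (empty (spokes x) spokes-elim)
            where
            empty : ∀ ss → (∀ {s} → s ∈ ss → Spoke x s) → ∑ (share x) ss ≡ 0
            empty []       _     = refl
            empty (s ∷ ss) spoke = contradiction (spoke (here refl)) none

          -- In half units the surplus is 6 deg - 22; the last term lends a 3-vertex its deficit of
          -- 4, which `needs` covers. Degrees 3 and 4 are tight. At degree 5 three spokes cost 6 out
          -- of 8, and from degree 6 on even 2 for every neighbour is affordable.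
          budget : ∀ x → b2n (S x) * 22 + ∑ (give x) V ≤ b2n (S x) * (6 * deg S x) + 4 * b2n (does (Degree? S 3 x))
          budget x = by-degree (S x) (deg S x) low
            (λ x∉ → no-spokes λ { ((x∈ , _) , _) → contradiction (trans (≡-sym x∉) x∈) λ () })
            (λ d₃ → no-spokes λ { ((_ , 4≤) , _) → contradiction (subst (4 ≤_) d₃ 4≤) λ { (s≤s (s≤s (s≤s ()))) } })
            give₄
            (λ d₅ → ≤-trans (give-spokes x) (*-monoˡ-≤ 2 (spokes₅ d₅)))
            (≤-trans (give-spokes x) (*-monoˡ-≤ 2
              (length-⊆ (spokes-unique x) λ s∈ → let (_ , (s∈S , _) , xs , _) = spokes-elim {x} s∈ in nbrs-intro {S} s∈S xs)))
            where
            by-degree : ∀ b d {g} → (b ≡ true → 3 ≤ d) → (b ≡ false → g ≡ 0) → (d ≡ 3 → g ≡ 0) → (d ≡ 4 → g ≤ 2) → (d ≡ 5 → g ≤ 6) →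
                        g ≤ d * 2 → b2n b * 22 + g ≤ b2n b * (6 * d) + 4 * b2n (does ((b Bool.≟ true) ×-dec (d ℕ.≟ 3)))
            by-degree false d _ g≡0 _ _ _ _ = ≤-trans (≤-reflexive (g≡0 refl)) z≤n
            by-degree true 0 3≤d _ _ _ _ _ = contradiction (3≤d refl) λ ()
            by-degree true 1 3≤d _ _ _ _ _ = contradiction (3≤d refl) λ { (s≤s ()) }
            by-degree true 2 3≤d _ _ _ _ _ = contradiction (3≤d refl) λ { (s≤s (s≤s ())) }
            by-degree true 3 _ _ g≡0 _ _ _ = +-monoʳ-≤ 22 (≤-reflexive (g≡0 refl))
            by-degree true 4 _ _ _ g≤2 _ _ = +-monoʳ-≤ 22 (g≤2 refl)
            by-degree true 5 _ _ _ _ g≤6 _ = ≤-trans (+-monoʳ-≤ 22 (g≤6 refl)) (m≤m+n 28 2)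
            by-degree true (suc (suc (suc (suc (suc (suc d)))))) {g} _ _ _ _ _ g≤ = begin
              22 + g                          ≤⟨ +-monoʳ-≤ 22 g≤ ⟩
              -- The slack 2 + 4 d is the difference between 36 + 6 d and 34 + 2 d.
              22 + (6 + d) * 2                ≤⟨ m≤m+n _ (2 + 4 * d) ⟩
              22 + (6 + d) * 2 + (2 + 4 * d)
                ≡⟨ solve 1 (λ k → con 22 :+ (con 6 :+ k) :* con 2 :+ (con 2 :+ con 4 :* k) := con 1 :* (con 6 :* (con 6 :+ k)) :+ con 0) refl d ⟩
              1 * (6 * (6 + d)) + 0           ∎
              where
              open ≤-Reasoning
              open +-*-Solver

          pay-none : ∀ {w s v} → ¬ Link w s v → pay w s v ≡ 0
          pay-none {w} {s} {v} ¬link = cong (λ b → b2n b * worth v) (dec-false (Link? w s v) ¬link)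

          pay-link : ∀ {w s v} → Link w s v → pay w s v ≡ worth v
          pay-link {w} {s} {v} link = trans (cong (λ b → b2n b * worth v) (dec-true (Link? w s v) link)) (+-identityʳ (worth v))

          pay-bound : ∀ w s v → pay w s v ≤ b2n (does (Degree? S 3 s)) * worth v
          pay-bound w s v = bound (Link? w s v)
            where
            bound : (d : Dec (Link w s v)) → b2n (does d) * worth v ≤ b2n (does (Degree? S 3 s)) * worth v
            bound (no _)             = z≤n
            bound (yes (_ , s₃ , _)) = ≤-reflexive (cong (λ b → b2n b * worth v) (≡-sym (dec-true (Degree? S 3 s) s₃)))

          -- Only the two neighbours of an outer `w` are paid by it, each on account of the other.
          -- Two 3-vertices get one half unit each, a single one gets both.
          pay-total : ∀ w → ∑ (λ s → ∑ (pay w s) V) V ≤ 2 * b2n (outer S w)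
          pay-total w = bound ((S w Bool.≟ false) ×-dec (deg S w ℕ.≟ 2))
            where
            bound : Dec (S w ≡ false × deg S w ≡ 2) → ∑ (λ s → ∑ (pay w s) V) V ≤ 2 * b2n (outer S w)
            bound (no ¬outer) = ≤-trans
              (≤-reflexive (trans (∑-cong V (λ s → trans (∑-cong V (λ v → pay-none (¬outer ∘ proj₁))) (∑-0 V))) (∑-0 V))) z≤n
            bound (yes (w∉ , d₂)) = ≤-trans (by-nbrs (nbrs S w) refl)
              (≤-reflexive (cong (λ b → 2 * b2n b) (≡-sym (cong₂ (λ a b → not a ∧ b) w∉ (dec-true (deg S w ℕ.≟ 2) d₂)))))
              where
              by-nbrs : ∀ ps → nbrs S w ≡ ps → ∑ (λ s → ∑ (pay w s) V) V ≤ 2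
              by-nbrs [] eq = contradiction (trans (≡-sym d₂) (cong length eq)) λ ()
              by-nbrs (_ ∷ []) eq = contradiction (trans (≡-sym d₂) (cong length eq)) λ ()
              by-nbrs (_ ∷ _ ∷ _ ∷ _) eq = contradiction (trans (≡-sym d₂) (cong length eq)) λ ()
              by-nbrs (p ∷ q ∷ []) eq = begin
                ∑ (λ s → ∑ (pay w s) V) V               ≤⟨ ∑-support (λ s → ∑ (pay w s) V) (p ∷ q ∷ []) outside ⟩
                ∑ (pay w p) V + (∑ (pay w q) V + 0)     ≤⟨ +-mono-≤ (row p q (λ z → z)) (+-monoˡ-≤ 0 (row q p λ { (here e) → there (here e) ; (there (here e)) → here e })) ⟩
                pay w p q + (pay w q p + 0)             ≤⟨ +-mono-≤ (pay-bound w p q) (+-monoˡ-≤ 0 (pay-bound w q p)) ⟩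
                b2n (does (Degree? S 3 p)) * worth q + (b2n (does (Degree? S 3 q)) * worth p + 0)
                                                        ≤⟨ at-most-two (does (Degree? S 3 p)) (does (Degree? S 3 q)) ⟩
                2                                       ∎
                where
                open ≤-Reasoning
                outside : ∀ {s} → s ∉ p ∷ q ∷ [] → ∑ (pay w s) V ≡ 0
                outside s∉ = trans (∑-cong V (λ v → pay-none (λ { (_ , _ , _ , s∈ , _) → s∉ (subst (_ ∈_) eq s∈) }))) (∑-0 V)
                row : ∀ s t → p ∷ q ∷ [] ⊆ s ∷ t ∷ [] → ∑ (pay w s) V ≤ pay w s t
                row s t ⊆st = ≤-trans (∑-support (pay w s) [ t ] vanishes) (≤-reflexive (+-identityʳ _))
                  where
                  vanishes : ∀ {v} → v ∉ [ t ] → pay w s v ≡ 0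
                  vanishes {v} v∉ = pay-none λ { (_ , _ , s≢v , _ , v∈) → not-here s≢v (⊆st (subst (v ∈_) eq v∈)) }
                    where
                    not-here : s ≢ v → ¬ (v ∈ s ∷ t ∷ [])
                    not-here s≢v (here v≡s)  = s≢v (≡-sym v≡s)
                    not-here s≢v (there v∈t) = v∉ v∈t
                at-most-two : ∀ d e → b2n d * (if e then 1 else 2) + (b2n e * (if d then 1 else 2) + 0) ≤ 2
                at-most-two true  true  = ≤-refl
                at-most-two true  false = ≤-refl
                at-most-two false true  = ≤-refl
                at-most-two false false = z≤n

          receive≥give : ∀ {s v k} → k ≤ give v s → k ≤ receive s v
          receive≥give k≤ = ≤-trans k≤ (m≤m+n _ _)

          receive≥pay : ∀ {s v} w → Link w s v → worth v ≤ receive s v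
          receive≥pay {s} {v} w link = ≤-trans (≤-reflexive (≡-sym (pay-link link)))
            (≤-trans (term≤∑ (λ w → pay w s v) w) (m≤n+m _ (give v s)))

          1≤worth : ∀ v → 1 ≤ worth v
          1≤worth v = proj₁ (one-or-two (does (Degree? S 3 v)))

          receive-demanded : ∀ {s t} → Degree S 3 s → Demanded S s t → 1 ≤ receive s t
          receive-demanded {s} {t} s₃ (w , w∉ , d₂ , s≢t , s∈ , t∈) =
            ≤-trans (1≤worth t) (receive≥pay w ((w∉ , d₂) , s₃ , s≢t , s∈ , t∈))

          -- The half case remembers the other spoke `t`, through which the missing half unit may be
          -- recovered.
          data Paid (s x : Fin n) : Set where
            full : 2 ≤ receive s x → Paid s x
            half : ∀ t → deg S x ≡ 4 → Spoke x s → Spoke x t → t ≢ s → 1 ≤ receive s x → Paid s x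

          paid≥1 : ∀ {s x} → Paid s x → 1 ≤ receive s x
          paid≥1 (full 2≤)           = ≤-trans (s≤s z≤n) 2≤
          paid≥1 (half _ _ _ _ _ 1≤) = 1≤

          -- If `x` and `s` form a demanded pair, the demand pays in full because `x` is not a
          -- 3-vertex. Otherwise `low` gives `x` degree at least 4, so `s` is a spoke of `x`, and
          -- `Split` separates half from full.
          paid : ∀ {s x} → Degree S 3 s → x ∈ˢ S → Adj s x → ¬ Degree S 3 x → Paid s x
          paid {s} {x} s₃ x∈S sx ¬x₃ = by-demand (Demanded? S x s)
            where
            by-demand : Dec (Demanded S x s) → Paid s x
            by-demand (yes (w , w∉ , d₂ , x≢s , x∈ , s∈)) = full (subst (_≤ receive s x) (cong (λ b → if b then 1 else 2) (dec-false (Degree? S 3 x) ¬x₃))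
                   (receive≥pay w ((w∉ , d₂) , s₃ , ≢-sym x≢s , s∈ , x∈)))
            by-demand (no free) = by-share (split? x s) refl
              where
              spoke : Spoke x s
              spoke = (x∈S , ≤∧≢⇒< (low x∈S) (λ 3≡d → ¬x₃ (x∈S , ≡-sym 3≡d))) , s₃ , Adj-sym sx , free
              give≡share : give x s ≡ share x s
              give≡share = trans (cong (λ b → b2n b * share x s) (dec-true (Spoke? x s) spoke)) (+-identityʳ (share x s))
              by-share : (d : Dec (Split x s)) → split? x s ≡ d → Paid s x
              by-share (yes (d₄ , t , spoke′ , t≢s)) eq = half t d₄ spoke spoke′ t≢s
                (receive≥give (≤-reflexive (≡-sym (trans give≡share (cong (λ d → if does d then 1 else 2) eq)))))
              by-share (no _) eq = full
                (receive≥give (≤-reflexive (≡-sym (trans give≡share (cong (λ d → if does d then 1 else 2) eq)))))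

          -- By `fork` two spokes of a 4-vertex form a demanded pair; that demand compensates `s`
          -- for what `x` gives to `t`.
          partner-demanded : ∀ {s x t} → deg S x ≡ 4 → Spoke x s → Spoke x t → t ≢ s → 1 ≤ receive s t
          partner-demanded d₄ spoke@(_ , s₃ , _) spoke′ t≢s = receive-demanded s₃ (fork d₄ spoke spoke′ (≢-sym t≢s))

          received : Fin n → ℕ
          received s = ∑ (receive s) V

          -- Two full payments make four half units. If some neighbour pays only half, its other
          -- spoke `t` adds a half unit to the one from each of `p`, `q`, `r`; being a 3-vertex, `t`
          -- differs from all three.
          isolated-received : ∀ {s p q r} → Unique (p ∷ q ∷ r ∷ []) → (∀ {x} → x ∈ p ∷ q ∷ r ∷ [] → ¬ Degree S 3 x) →
                              Paid s p → Paid s q → Paid s r → 4 ≤ received s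
          isolated-received {s} {p} {q} {r} un ¬₃ pp pq pr = cases pp pq pr
            where
            with-partner : ∀ {x t} → deg S x ≡ 4 → Spoke x s → Spoke x t → t ≢ s → 4 ≤ received s
            with-partner {t = t} d₄ spoke spoke′@(_ , t₃ , _) t≢s = ≤-trans
              (+-mono-≤ (partner-demanded d₄ spoke spoke′ t≢s) (+-mono-≤ (paid≥1 pp) (+-mono-≤ (paid≥1 pq) (+-monoˡ-≤ 0 (paid≥1 pr)))))
              (∑-≥ (receive s) {t ∷ p ∷ q ∷ r ∷ []} (All.tabulate (λ { x∈ refl → ¬₃ x∈ t₃ }) ∷ un))
            cases : Paid s p → Paid s q → Paid s r → 4 ≤ received s
            cases (half _ d₄ spoke spoke′ t≢s _) _ _ = with-partner d₄ spoke spoke′ t≢s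
            cases (full _) (half _ d₄ spoke spoke′ t≢s _) _ = with-partner d₄ spoke spoke′ t≢s
            cases (full _) (full _) (half _ d₄ spoke spoke′ t≢s _) = with-partner d₄ spoke spoke′ t≢s
            cases (full p₂) (full q₂) (full r₂) = ≤-trans (+-mono-≤ p₂ (+-monoˡ-≤ 0 q₂))
              (∑-≥ (receive s) {p ∷ q ∷ []} (first-two un))
              where
              first-two : Unique (p ∷ q ∷ r ∷ []) → Unique (p ∷ q ∷ [])
              first-two ((p≢q ∷ _) ∷ _) = unique₂ p≢q

          -- By `edge` the demand on `a` and `b` gives one half unit, so one full and one half
          -- payment suffice beside it. If both `x` and `y` pay half, another spoke different from
          -- `b` supplies the missing half unit; if both other spokes are `b`, the configuration of
          -- `diamond` arises.
          paired-received : ∀ {a b x y} → Degree S 3 a → Degree S 3 b → Adj a b → x ≢ y → ¬ Degree S 3 x → ¬ Degree S 3 y →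
                            Paid a x → Paid a y → 4 ≤ received a
          paired-received {a} {b} {x} {y} a₃ b₃ ab x≢y ¬x₃ ¬y₃ px py = cases px py
            where
            from-b : 1 ≤ receive a b
            from-b = receive-demanded a₃ (edge a₃ b₃ ab)
            b≢ : ∀ {z} → ¬ Degree S 3 z → b ≢ z
            b≢ ¬z₃ refl = ¬z₃ b₃
            three : Unique (b ∷ x ∷ y ∷ [])
            three = unique₃ (b≢ ¬x₃) (b≢ ¬y₃) x≢y
            with-partner : ∀ {z t} → deg S z ≡ 4 → Spoke z a → Spoke z t → t ≢ a → t ≢ b → 4 ≤ received a
            with-partner {t = t} d₄ spoke spoke′@(_ , t₃ , _) t≢a t≢b = ≤-trans
              (+-mono-≤ (partner-demanded d₄ spoke spoke′ t≢a) (+-mono-≤ from-b (+-mono-≤ (paid≥1 px) (+-monoˡ-≤ 0 (paid≥1 py)))))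
              (∑-≥ (receive a) {t ∷ b ∷ x ∷ y ∷ []}
                ((t≢b ∷ (λ { refl → ¬x₃ t₃ }) ∷ (λ { refl → ¬y₃ t₃ }) ∷ []) ∷ three))
            plain : ∀ {k l} → k ≤ receive a x → l ≤ receive a y → 1 + (k + (l + 0)) ≤ received a
            plain k≤ l≤ = ≤-trans (+-mono-≤ from-b (+-mono-≤ k≤ (+-monoˡ-≤ 0 l≤))) (∑-≥ (receive a) three)
            cases : Paid a x → Paid a y → 4 ≤ received a
            cases (full x₂) py = plain x₂ (paid≥1 py)
            cases (half _ _ _ _ _ x₁) (full y₂) = plain x₁ y₂
            cases (half t d₄ xa xt t≢a _) (half t′ d₄′ ya yt′ t′≢a _) with t ≟ b | t′ ≟ b
            ... | no t≢b   | _         = with-partner d₄ xa xt t≢a t≢b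
            ... | yes _    | no t′≢b   = with-partner d₄′ ya yt′ t′≢a t′≢b
            ... | yes refl | yes refl  = contradiction (diamond ab x≢y d₄ d₄′ xa xt ya yt′) (proj₂ (proj₂ (proj₂ xa)))

          -- By `path` at most one neighbour of `s` is a 3-vertex, which leaves the situations of
          -- `isolated-received` and `paired-received`.
          cubic-received : ∀ {s} → Degree S 3 s → 4 ≤ received s
          cubic-received {s} s₃ = by-nbrs (nbrs S s) refl
            where
            by-nbrs : ∀ ps → nbrs S s ≡ ps → 4 ≤ received s
            by-nbrs [] eq = contradiction (trans (≡-sym (proj₂ s₃)) (cong length eq)) λ ()
            by-nbrs (_ ∷ []) eq = contradiction (trans (≡-sym (proj₂ s₃)) (cong length eq)) λ ()
            by-nbrs (_ ∷ _ ∷ []) eq = contradiction (trans (≡-sym (proj₂ s₃)) (cong length eq)) λ ()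
            by-nbrs (_ ∷ _ ∷ _ ∷ _ ∷ _) eq = contradiction (trans (≡-sym (proj₂ s₃)) (cong length eq)) λ ()
            by-nbrs (p ∷ q ∷ r ∷ []) eq = by-degrees (subst Unique eq (nbrs-unique S s)) (Degree? S 3 p) (Degree? S 3 q) (Degree? S 3 r)
              where
              nbr : ∀ {x} → x ∈ p ∷ q ∷ r ∷ [] → x ∈ˢ S × Adj s x
              nbr x∈ = nbrs-elim {S} (subst (_ ∈_) (≡-sym eq) x∈)
              settle : ∀ {x} → x ∈ p ∷ q ∷ r ∷ [] → ¬ Degree S 3 x → Paid s x
              settle x∈ = paid s₃ (proj₁ (nbr x∈)) (proj₂ (nbr x∈))
              p∈ : p ∈ p ∷ q ∷ r ∷ []
              p∈ = here refl
              q∈ : q ∈ p ∷ q ∷ r ∷ []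
              q∈ = there (here refl)
              r∈ : r ∈ p ∷ q ∷ r ∷ []
              r∈ = there (there (here refl))
              only : ∀ {u w} → u ∈ p ∷ q ∷ r ∷ [] → w ∈ p ∷ q ∷ r ∷ [] → u ≢ w → Degree S 3 u → ¬ Degree S 3 w
              only u∈ w∈ u≢w u₃ w₃ = u≢w (path u₃ s₃ w₃ (proj₂ (nbr u∈)) (proj₂ (nbr w∈)))
              paired : ∀ {b x y} → b ∈ p ∷ q ∷ r ∷ [] → x ∈ p ∷ q ∷ r ∷ [] → y ∈ p ∷ q ∷ r ∷ [] →
                       Degree S 3 b → b ≢ x → b ≢ y → x ≢ y → 4 ≤ received s
              paired b∈ x∈ y∈ b₃ b≢x b≢y x≢y =
                let ¬x₃ = only b∈ x∈ b≢x b₃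
                    ¬y₃ = only b∈ y∈ b≢y b₃
                in paired-received s₃ b₃ (proj₂ (nbr b∈)) x≢y ¬x₃ ¬y₃ (settle x∈ ¬x₃) (settle y∈ ¬y₃)
              by-degrees : Unique (p ∷ q ∷ r ∷ []) → Dec (Degree S 3 p) → Dec (Degree S 3 q) → Dec (Degree S 3 r) → 4 ≤ received s
              by-degrees ((p≢q ∷ p≢r ∷ []) ∷ (q≢r ∷ []) ∷ _) (yes p₃) _ _ = paired p∈ q∈ r∈ p₃ p≢q p≢r q≢r
              by-degrees ((p≢q ∷ p≢r ∷ []) ∷ (q≢r ∷ []) ∷ _) (no _) (yes q₃) _ = paired q∈ p∈ r∈ q₃ (≢-sym p≢q) q≢r p≢r
              by-degrees ((p≢q ∷ p≢r ∷ []) ∷ (q≢r ∷ []) ∷ _) (no _) (no _) (yes r₃) = paired r∈ p∈ q∈ r₃ (≢-sym p≢r) (≢-sym q≢r) p≢q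
              by-degrees un (no ¬p₃) (no ¬q₃) (no ¬r₃) = isolated-received un
                (λ { (here refl) → ¬p₃ ; (there (here refl)) → ¬q₃ ; (there (there (here refl))) → ¬r₃ })
                (settle p∈ ¬p₃) (settle q∈ ¬q₃) (settle r∈ ¬r₃)

          needs : ∀ s → 4 * b2n (does (Degree? S 3 s)) ≤ received s
          needs s = by-degree (Degree? S 3 s)
            where
            by-degree : (d : Dec (Degree S 3 s)) → 4 * b2n (does d) ≤ received s
            by-degree (yes s₃) = cubic-received s₃
            by-degree (no _)   = z≤n

          received-total : ∑ received V ≤ ∑ (λ x → ∑ (give x) V) V + 2 * ∑ (b2n ∘ outer S) V
          received-total = begin
            ∑ received V
              ≡⟨ ∑-cong V (λ s → ∑-+ (λ v → give v s) (λ v → ∑ (λ w → pay w s v) V) V) ⟩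
            ∑ (λ s → ∑ (λ v → give v s) V + ∑ (λ v → ∑ (λ w → pay w s v) V) V) V
              ≡⟨ ∑-+ (λ s → ∑ (λ v → give v s) V) (λ s → ∑ (λ v → ∑ (λ w → pay w s v) V) V) V ⟩
            ∑ (λ s → ∑ (λ v → give v s) V) V + ∑ (λ s → ∑ (λ v → ∑ (λ w → pay w s v) V) V) V
              ≡⟨ cong₂ _+_ (∑-swap (λ s v → give v s) V V)
                           (trans (∑-cong V (λ s → ∑-swap (λ v w → pay w s v) V V)) (∑-swap (λ s w → ∑ (pay w s) V) V V)) ⟩
            ∑ (λ x → ∑ (give x) V) V + ∑ (λ w → ∑ (λ s → ∑ (pay w s) V) V) V
              ≤⟨ +-monoʳ-≤ (∑ (λ x → ∑ (give x) V) V) (∑-mono V pay-total) ⟩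
            ∑ (λ x → ∑ (give x) V) V + ∑ (λ w → 2 * b2n (outer S w)) V
              ≡⟨ cong (∑ (λ x → ∑ (give x) V) V +_) (∑-*ˡ 2 (b2n ∘ outer S) V) ⟩
            ∑ (λ x → ∑ (give x) V) V + 2 * ∑ (b2n ∘ outer S) V ∎
            where open ≤-Reasoning

        -- In the sum of `budget` over all vertices, the lent deficits are bounded through `needs`
        -- and `received-total`. The total of all gifts then stands on both sides and cancels, as
        -- does the factor 2 of the half units.
        irreducible-dense : 11 * ∑ (b2n ∘ S) (allFin n) ≤
                            3 * ∑ (λ u → b2n (S u) * deg S u) (allFin n) + ∑ (b2n ∘ outer S) (allFin n)
        irreducible-dense = *-cancelˡ-≤ 2 (+-cancelʳ-≤ given _ _ (begin
          2 * (11 * size) + given                      ≡⟨ cong (_+ given) (solve 1 (λ s → con 2 :* (con 11 :* s) := con 22 :* s) refl size) ⟩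
          22 * size + given                            ≡⟨ cong (_+ given) (trans (∑-cong V (λ x → *-comm (b2n (S x)) 22)) (∑-*ˡ 22 (b2n ∘ S) V)) ⟨
          ∑ (λ x → b2n (S x) * 22) V + given           ≡⟨ ∑-+ (λ x → b2n (S x) * 22) (λ x → ∑ (give x) V) V ⟨
          ∑ (λ x → b2n (S x) * 22 + ∑ (give x) V) V    ≤⟨ ∑-mono V budget ⟩
          ∑ (λ x → b2n (S x) * (6 * deg S x) + 4 * b2n (does (Degree? S 3 x))) V
            ≡⟨ ∑-+ (λ x → b2n (S x) * (6 * deg S x)) (λ x → 4 * b2n (does (Degree? S 3 x))) V ⟩
          ∑ (λ x → b2n (S x) * (6 * deg S x)) V + ∑ (λ x → 4 * b2n (does (Degree? S 3 x))) V
            ≤⟨ +-mono-≤ (≤-reflexive (trans (∑-cong V (λ x → solve 2 (λ b d → b :* (con 6 :* d) := con 6 :* (b :* d)) refl (b2n (S x)) (deg S x)))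
                                            (∑-*ˡ 6 (λ x → b2n (S x) * deg S x) V)))
                        (≤-trans (∑-mono V needs) received-total) ⟩
          6 * degrees + (given + 2 * W)                ≡⟨ solve 3 (λ d g w → con 6 :* d :+ (g :+ con 2 :* w) := con 2 :* (con 3 :* d :+ w) :+ g) refl degrees given W ⟩
          2 * (3 * degrees + W) + given                ∎))
          where
          open ≤-Reasoning
          open +-*-Solver
          size    = ∑ (b2n ∘ S) V
          given   = ∑ (λ x → ∑ (give x) V) V
          degrees = ∑ (λ u → b2n (S u) * deg S u) V
          W       = ∑ (b2n ∘ outer S) V

    -- List colourings and their greedy extension.

    module _ (L : Fin n → Vec ℕ 4) (L-distinct : IsKAssignment L) where

      Coloring : Set
      Coloring = Fin n → Fin 4

      colour : Coloring → Fin n → ℕ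
      colour φ v = lookup (L v) (φ v)

      Proper : VertexSet → Coloring → Set
      Proper S φ = ∀ {u v} → u ∈ˢ S → v ∈ˢ S → Adj u v → colour φ u ≢ colour φ v

      palette : Fin n → List ℕ
      palette v = map (lookup (L v)) (allFin 4)

      palette-unique : ∀ v → Unique (palette v)
      palette-unique v = Unique.map⁺ (L-distinct v _ _) (Unique.allFin⁺ 4)

      ∈-palette : ∀ v i → lookup (L v) i ∈ palette v
      ∈-palette v i = ∈-map⁺ (lookup (L v)) (∈-allFin i)

      pick : ∀ v F → length F ≤ 3 → ∃ λ i → lookup (L v) i ∉ F
      pick v F |F|≤3 with any? (λ i → ¬? (DecMembership._∈?_ ℕ._≟_ (lookup (L v) i) F))
      ... | yes found = found
      ... | no none   = contradiction (length-⊆ (palette-unique v) palette⊆F) (<⇒≱ (s≤s |F|≤3))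
        where
        palette⊆F : palette v ⊆ F
        palette⊆F c∈ with ∈-map⁻ (lookup (L v)) c∈
        ... | i , _ , refl = decidable-stable (DecMembership._∈?_ ℕ._≟_ _ F) (λ c∉F → none (i , c∉F))

      infixl 9 _[_≔_]
      _[_≔_] : Coloring → Fin n → Fin 4 → Coloring
      (φ [ h ≔ i ]) v = if does (v ≟ h) then i else φ v

      update-≡ : ∀ φ h i → (φ [ h ≔ i ]) h ≡ i
      update-≡ φ h i with h ≟ h
      ... | yes _  = refl
      ... | no h≢h = contradiction refl h≢h

      update-≢ : ∀ φ h i {v} → v ≢ h → (φ [ h ≔ i ]) v ≡ φ v
      update-≢ φ h i {v} v≢h with v ≟ h
      ... | yes v≡h = contradiction v≡h v≢h
      ... | no _    = refl

      -- Colourings are total, and the values on the listed vertices do not count yet. Recolouring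
      -- `h` strikes it off the list.
      proper-update : ∀ {S U h φ} i → Proper (S ∖ (h ∷ U)) φ →
                      (∀ {z} → z ∈ˢ S ∖ (h ∷ U) → Adj h z → colour φ z ≢ lookup (L h) i) →
                      Proper (S ∖ U) (φ [ h ≔ i ])
      proper-update {S} {U} {h} {φ} i proper allowed {u} {v} u∈ v∈ e
        with u ≟ h | v ≟ h
      ... | yes refl | yes refl = contradiction refl (Adj⇒≢ e)
      ... | yes refl | no v≢h   = ≢-sym (allowed (∖-cons {S = S} v∈ v≢h) e)
      ... | no u≢h   | yes refl = allowed (∖-cons {S = S} u∈ u≢h) (Adj-sym e)
      ... | no u≢h   | no v≢h   = proper (∖-cons {S = S} u∈ u≢h) (∖-cons {S = S} v∈ v≢h) e

      -- The colours of the neighbours and those in `F` are at most three forbidden values against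
      -- four distinct list entries.
      allowed-avoiding : ∀ R h φ F → deg R h + length F ≤ 3 →
                         ∃ λ i → (∀ {z} → z ∈ˢ R → Adj h z → colour φ z ≢ lookup (L h) i) × lookup (L h) i ∉ F
      allowed-avoiding R h φ F room
        with pick h (map (colour φ) (nbrs R h) ++ F)
                  (subst (_≤ 3) (≡-sym (trans (length-++ (map (colour φ) (nbrs R h)))
                                              (cong (_+ length F) (length-map (colour φ) (nbrs R h))))) room)
      ... | i , i∉ = i
        , (λ z∈ e eq → i∉ (∈-++⁺ˡ (subst (_∈ _) eq (∈-map⁺ (colour φ) (nbrs-intro {R} z∈ e)))))
        , (λ i∈F → i∉ (∈-++⁺ʳ _ i∈F))

      -- A greedy order, head first: at the turn of `h` exactly its neighbours outside `h ∷ U` are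
      -- coloured, and at most three of them leave a free colour.
      data Orderly (S : VertexSet) : List (Fin n) → Set where
        []  : Orderly S []
        _∷_ : ∀ {h U} → deg (S ∖ (h ∷ U)) h ≤ 3 → Orderly S U → Orderly S (h ∷ U)

      record Extension (S : VertexSet) (H : List (Fin n)) (ψ : Coloring) : Set where
        constructor extension
        field
          φ      : Coloring
          agrees : ∀ {v} → v ∉ H → φ v ≡ ψ v
          proper : Proper S φ

      open Extension public

      proper-∖ : ∀ {S U U′ φ} → U ⊆ U′ → Proper (S ∖ U) φ → Proper (S ∖ U′) φ
      proper-∖ {S} U⊆U′ proper u∈ v∈ = proper (∖-mono {S = S} U⊆U′ u∈) (∖-mono {S = S} U⊆U′ v∈)

      complete : ∀ {S U ψ} → Orderly S U → Proper (S ∖ U) ψ → Extension S U ψ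
      complete {S} {ψ = ψ} [] proper =
        extension ψ (λ _ → refl) (λ u∈ v∈ → proper (∖-intro {S = S} {[]} u∈ (λ ())) (∖-intro {S = S} {[]} v∈ (λ ())))
      complete {S} {h ∷ U} {ψ} (room ∷ rest) proper
        with allowed-avoiding (S ∖ (h ∷ U)) h ψ [] (subst (_≤ 3) (≡-sym (+-identityʳ _)) room)
      ... | i , allowed , _ with complete rest (proper-update {S} i proper allowed)
      ... | extension φ agrees proper′ = extension φ
        (λ v∉ → trans (agrees (v∉ ∘ there)) (update-≢ ψ h i (v∉ ∘ here))) proper′

      module _ {S : VertexSet {n}} {H : List (Fin n)} {ψ : Coloring} {u U}
               (H⊆ : H ⊆ u ∷ U) (⊆H : u ∷ U ⊆ H) (u∉U : u ∉ U) (orderly : Orderly S U) where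

        -- The vertex `u` takes its prescribed entry first and the rest is completed greedily; `u∉U`
        -- protects the choice from later steps.
        extend-at : Proper (S ∖ H) ψ → ∀ i →
                    (∀ {z} → z ∈ˢ S ∖ H → Adj u z → colour ψ z ≢ lookup (L u) i) →
                    Σ (Extension S H ψ) λ e → φ e u ≡ i
        extend-at proper i allowed
          with complete orderly (proper-update {S} i (proper-∖ {S} H⊆ proper)
                                   (λ z∈ → allowed (∖-mono {S = S} H⊆ z∈)))
        ... | extension φ agrees proper′ =
          extension φ (λ v∉ → trans (agrees (v∉ ∘ ⊆H ∘ there)) (update-≢ ψ u i (λ { refl → v∉ (⊆H (here refl)) })))
                      proper′
          , trans (agrees u∉U) (update-≡ ψ u i)

      Avoiding : VertexSet → List (Fin n) → Coloring → Fin n → Fin n → ℕ → Set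
      Avoiding S H ψ u v c = Σ (Extension S H ψ) λ e → colour (φ e) u ≢ c × colour (φ e) v ≢ c

      module _ {S : VertexSet {n}} {H : List (Fin n)} {ψ : Coloring} {u v U}
               (H⊆ : H ⊆ u ∷ v ∷ U) (⊆H : u ∷ v ∷ U ⊆ H) (u∉ : u ∉ v ∷ U) (v∉U : v ∉ U)
               (room₁ : deg (S ∖ (u ∷ v ∷ U)) u ≤ 2) (room₂ : deg (S ∖ (v ∷ U)) v ≤ 2)
               (orderly : Orderly S U) where

        -- First `u` and then `v` is coloured; each has at most two coloured neighbours at its turn,
        -- so `c` can be a third forbidden colour.
        extend-avoiding : Proper (S ∖ H) ψ → ∀ c → Avoiding S H ψ u v c
        extend-avoiding proper c
          with allowed-avoiding (S ∖ (u ∷ v ∷ U)) u ψ [ c ] (+-monoˡ-≤ 1 room₁)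
        ... | i , allowed , i∉
          with allowed-avoiding (S ∖ (v ∷ U)) v (ψ [ u ≔ i ]) [ c ] (+-monoˡ-≤ 1 room₂)
        ... | j , allowed′ , j∉
          with complete orderly (proper-update {S} j (proper-update {S} i (proper-∖ {S} H⊆ proper) allowed) allowed′)
        ... | extension φ agrees proper′ =
          extension φ
            (λ w∉ → trans (agrees (w∉ ∘ ⊆H ∘ there ∘ there))
                   (trans (update-≢ (ψ [ u ≔ i ]) v j (λ { refl → w∉ (⊆H (there (here refl))) }))
                          (update-≢ ψ u i (λ { refl → w∉ (⊆H (here refl)) }))))
            proper′
          , (λ eq → i∉ (here (trans (cong (lookup (L u)) (≡-sym φu)) eq)))
          , (λ eq → j∉ (here (trans (cong (lookup (L v)) (≡-sym φv)) eq)))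
          where
          φu : φ u ≡ i
          φu = trans (agrees (u∉ ∘ there)) (trans (update-≢ (ψ [ u ≔ i ]) v j (λ { refl → u∉ (here refl) })) (update-≡ ψ u i))
          φv : φ v ≡ j
          φv = trans (agrees v∉U) (update-≡ (ψ [ u ≔ i ]) v j)

      -- The second alternative of pair is for K₄, where a vertex outside H has to cooperate.
      record Reducible (S : VertexSet) : Set where
        field
          H        : List (Fin n)
          nonempty : ∃ λ h → h ∈ H
          bounded  : length H ≤ 5
          inside   : ∀ {h} → h ∈ H → h ∈ˢ S
          few      : ∀ {u} → u ∈ H → deg (S ∖ H) u ≤ 2
          single   : ∀ {u} → u ∈ H → ∀ {ψ} → Proper (S ∖ H) ψ → ∀ i →
                     (∀ {z} → z ∈ˢ S ∖ H → Adj u z → colour ψ z ≢ lookup (L u) i) →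
                     Σ (Extension S H ψ) λ e → φ e u ≡ i
          pair     : ∀ {u v} → u ∈ H → v ∈ H → Demanded S u v → ∀ c →
                     (∀ {ψ} → Proper (S ∖ H) ψ → Avoiding S H ψ u v c) ⊎
                     (∃ λ z → ∃ λ g → z ∈ˢ S ∖ H ×
                       (∀ {ψ} → Proper (S ∖ H) ψ → colour ψ z ≢ g → Avoiding S H ψ u v c))

      -- Reducible configurations.

      module _ (S : VertexSet {n}) where

        room : ∀ {U h} k P → Unique P → P ⊆ U → P ⊆ nbrs S h → deg S h ≤ k + length P → deg (S ∖ U) h ≤ k
        room {U} {h} k P un P⊆U P⊆nbrs bound =
          +-cancelʳ-≤ (length P) _ k (≤-trans (deg-∖ {S} {U} {h} P un P⊆U P⊆nbrs) bound)

        room₀ : ∀ {U h} k → deg S h ≤ k → deg (S ∖ U) h ≤ k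
        room₀ k bound = room k [] [] (λ ()) (λ ()) (≤-trans bound (m≤m+n k 0))

        room₁ : ∀ {U h} k p → p ∈ U → p ∈ˢ S → Adj h p → deg S h ≤ k + 1 → deg (S ∖ U) h ≤ k
        room₁ k p p∈U p∈S e = room k [ p ] ([] ∷ []) (λ { (here refl) → p∈U }) (λ { (here refl) → nbrs-intro {S} p∈S e })

        room₂ : ∀ {U h} k p q → p ≢ q → p ∈ U → q ∈ U → p ∈ˢ S → q ∈ˢ S → Adj h p → Adj h q →
                deg S h ≤ k + 2 → deg (S ∖ U) h ≤ k
        room₂ k p q p≢q p∈U q∈U p∈S q∈S e e′ = room k (p ∷ q ∷ []) (unique₂ p≢q)
          (λ { (here refl) → p∈U ; (there (here refl)) → q∈U })
          (λ { (here refl) → nbrs-intro {S} p∈S e ; (there (here refl)) → nbrs-intro {S} q∈S e′ })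

        cubic-orderly : ∀ {U} → (∀ {h} → h ∈ U → Degree S 3 h) → Orderly S U
        cubic-orderly {[]}    cubic = []
        cubic-orderly {h ∷ U} cubic = room₀ 3 (≤-reflexive (proj₂ (cubic (here refl)))) ∷ cubic-orderly (cubic ∘ there)

        -- A greedy order of `H` that starts with `u`; the inclusions make `u ∷ U` the same set as
        -- `H`. It supplies the fields `few` and `single` of `Reducible`.
        record Leads (H : List (Fin n)) (u : Fin n) : Set where
          constructor leads
          field
            U       : List (Fin n)
            H⊆      : H ⊆ u ∷ U
            ⊆H      : u ∷ U ⊆ H
            u∉      : u ∉ U
            free    : deg (S ∖ (u ∷ U)) u ≤ 2
            orderly : Orderly S U

        -- Here `free₂` counts `u` among the coloured neighbours of `v` if the two are adjacent.
        record LeadsPair (H : List (Fin n)) (u v : Fin n) : Set where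
          constructor leads
          field
            U       : List (Fin n)
            H⊆      : H ⊆ u ∷ v ∷ U
            ⊆H      : u ∷ v ∷ U ⊆ H
            u∉      : u ∉ v ∷ U
            v∉      : v ∉ U
            free₁   : deg (S ∖ (u ∷ v ∷ U)) u ≤ 2
            free₂   : deg (S ∖ (v ∷ U)) v ≤ 2
            orderly : Orderly S U

        PairAvoidable : List (Fin n) → Fin n → Fin n → Set
        PairAvoidable H u v = ∀ c →
          (∀ {ψ} → Proper (S ∖ H) ψ → Avoiding S H ψ u v c) ⊎
          (∃ λ z → ∃ λ g → z ∈ˢ S ∖ H ×
            (∀ {ψ} → Proper (S ∖ H) ψ → colour ψ z ≢ g → Avoiding S H ψ u v c))

        pair-avoidable : ∀ {H u v} → LeadsPair H u v → PairAvoidable H u v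
        pair-avoidable (leads U H⊆ ⊆H u∉ v∉ free₁ free₂ orderly) c =
          inj₁ (λ proper → extend-avoiding {S} H⊆ ⊆H u∉ v∉ free₁ free₂ orderly proper c)

        private
          swap : ∀ {H ψ u v c} → Avoiding S H ψ u v c → Avoiding S H ψ v u c
          swap (e , p , q) = e , q , p

        pair-avoidable-sym : ∀ {H u v} → PairAvoidable H u v → PairAvoidable H v u
        pair-avoidable-sym {H} {u} {v} avoidable c with avoidable c
        ... | inj₁ f                = inj₁ (λ proper → swap (f proper))
        ... | inj₂ (z , g , z∈ , f) = inj₂ (z , g , z∈ , λ proper z≢g → swap (f proper z≢g))

        reducible : ∀ h H → length H ≤ 4 → (∀ {u} → u ∈ h ∷ H → u ∈ˢ S) → (∀ {u} → u ∈ h ∷ H → Leads (h ∷ H) u) →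
                    (∀ {u v} → u ∈ h ∷ H → v ∈ h ∷ H → Demanded S u v → PairAvoidable (h ∷ H) u v) →
                    Reducible S
        reducible h H bounded inside lead pair = record
          { H        = h ∷ H
          ; nonempty = h , here refl
          ; bounded  = s≤s bounded
          ; inside   = inside
          ; few      = λ {u} u∈ → few (lead u∈)
          ; single   = λ u∈ proper i allowed → single (lead u∈) proper i allowed
          ; pair     = pair
          }
          where
          few : ∀ {u} → Leads (h ∷ H) u → deg (S ∖ (h ∷ H)) u ≤ 2
          few {u} (leads U H⊆ ⊆H u∉ free orderly) =
            ≤-trans (deg-mono {S ∖ (u ∷ U)} {S ∖ (h ∷ H)} {u} (∖-mono {S = S} ⊆H)) free
          single : ∀ {u} → Leads (h ∷ H) u → ∀ {ψ} → Proper (S ∖ (h ∷ H)) ψ → ∀ i →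
                   (∀ {z} → z ∈ˢ S ∖ (h ∷ H) → Adj u z → colour ψ z ≢ lookup (L u) i) →
                   Σ (Extension S (h ∷ H) ψ) λ e → φ e u ≡ i
          single (leads U H⊆ ⊆H u∉ free orderly) proper i allowed =
            extend-at {S} H⊆ ⊆H u∉ orderly proper i allowed

        low-degree-reducible : ∀ {v} → v ∈ˢ S → deg S v ≤ 2 → Reducible S
        low-degree-reducible {v} v∈S low = reducible v [] z≤n (λ { (here refl) → v∈S })
          (λ { (here refl) → leads [] (λ z → z) (λ z → z) (λ ()) (room₀ 2 low) [] })
          (λ { (here refl) (here refl) (_ , _ , _ , v≢v , _) → contradiction refl v≢v })

        module _ {h H} (bounded : length H ≤ 4) (cubic : ∀ {u} → u ∈ h ∷ H → Degree S 3 u)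
                 (joined : ∀ {u} → u ∈ h ∷ H → ∃ λ p → p ∈ h ∷ H × Adj u p)
                 (pair : ∀ {u v} → u ∈ h ∷ H → v ∈ h ∷ H → Demanded S u v →
                         (∃ λ p → p ∈ h ∷ H × Adj v p × p ≢ u) ⊎ (∃ λ p → p ∈ h ∷ H × Adj u p × p ≢ v)) where

          private
            H₊ = h ∷ H

            cubic-leads : ∀ {u} → u ∈ H₊ → Leads H₊ u
            cubic-leads {u} u∈ with joined u∈
            ... | p , p∈ , e = leads (without u H₊) (⊆-without u H₊)
              (λ { (here refl) → u∈ ; (there v∈) → proj₁ (without-∈ H₊ v∈) })
              (λ u∈′ → proj₂ (without-∈ H₊ u∈′) refl)
              (room₁ 2 p (there (∈-without p∈ (≢-sym (Adj⇒≢ e)))) (proj₁ (cubic p∈)) e (≤-reflexive (proj₂ (cubic u∈))))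
              (cubic-orderly (λ v∈ → cubic (proj₁ (without-∈ H₊ v∈))))

            cubic-pair : ∀ {u v} → u ∈ H₊ → v ∈ H₊ → u ≢ v → (∃ λ p → p ∈ H₊ × Adj v p × p ≢ u) → LeadsPair H₊ u v
            cubic-pair {u} {v} u∈ v∈ u≢v (p , p∈ , e , p≢u) with joined u∈
            ... | q , q∈ , e′ = leads U
              (λ z∈ → split (⊆-without u H₊ z∈))
              (λ { (here refl) → u∈ ; (there (here refl)) → v∈ ; (there (there z∈)) → proj₁ (U⊆ z∈) })
              (λ { (here u≡v) → u≢v u≡v ; (there u∈U) → proj₁ (proj₂ (U⊆ u∈U)) refl })
              (λ v∈U → proj₂ (proj₂ (U⊆ v∈U)) refl)
              (room₁ 2 q (split (there (∈-without q∈ (≢-sym (Adj⇒≢ e′))))) (proj₁ (cubic q∈)) e′ (≤-reflexive (proj₂ (cubic u∈))))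
              (room₁ 2 p (there (∈-without (∈-without p∈ p≢u) (≢-sym (Adj⇒≢ e)))) (proj₁ (cubic p∈)) e (≤-reflexive (proj₂ (cubic v∈))))
              (cubic-orderly (λ z∈ → cubic (proj₁ (U⊆ z∈))))
              where
              U = without v (without u H₊)
              U⊆ : ∀ {z} → z ∈ U → z ∈ H₊ × z ≢ u × z ≢ v
              U⊆ z∈ with without-∈ (without u H₊) z∈
              ... | z∈′ , z≢v with without-∈ H₊ z∈′
              ... | z∈″ , z≢u = z∈″ , z≢u , z≢v
              split : ∀ {z} → z ∈ u ∷ without u H₊ → z ∈ u ∷ v ∷ U
              split (here z≡u) = here z≡u
              split (there z∈) = there (⊆-without v (without u H₊) z∈)

          -- 3-vertices can be coloured greedily in any order, and `joined` leaves each at most two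
          -- neighbours outside the configuration. Of a demanded pair, the end with a further
          -- neighbour inside is coloured second: that neighbour is still uncoloured, so one more
          -- colour can be avoided.
          cubic-reducible : Reducible S
          cubic-reducible = reducible h H bounded (λ u∈ → proj₁ (cubic u∈)) cubic-leads pair′
            where
            pair′ : ∀ {u v} → u ∈ H₊ → v ∈ H₊ → Demanded S u v → PairAvoidable H₊ u v
            pair′ u∈ v∈ dem@(_ , _ , _ , u≢v , _) with pair u∈ v∈ dem
            ... | inj₁ other = pair-avoidable (cubic-pair u∈ v∈ u≢v other)
            ... | inj₂ other = pair-avoidable-sym (pair-avoidable (cubic-pair v∈ u∈ (≢-sym u≢v) other))

        cubic-edge-reducible : ∀ {a b} → Degree S 3 a → Degree S 3 b → Adj a b → ¬ Demanded S a b → Reducible S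
        cubic-edge-reducible {a} {b} a₃ b₃ ab free = cubic-reducible {a} {[ b ]} (s≤s z≤n)
          (λ { (here refl) → a₃ ; (there (here refl)) → b₃ })
          (λ { (here refl) → b , there (here refl) , ab ; (there (here refl)) → a , here refl , Adj-sym ab })
          (λ { (here refl) (here refl) (_ , _ , _ , a≢a , _) → contradiction refl a≢a
             ; (here refl) (there (here refl)) dem → contradiction dem free
             ; (there (here refl)) (here refl) dem → contradiction (Demanded-sym {S} dem) free
             ; (there (here refl)) (there (here refl)) (_ , _ , _ , b≢b , _) → contradiction refl b≢b })

        -- In every pair of path vertices, one has a neighbour on the path different from the other,
        -- so any pair may be demanded.
        cubic-path-reducible : ∀ {u v w} → Degree S 3 u → Degree S 3 v → Degree S 3 w → Adj v u → Adj v w → u ≢ w → Reducible S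
        cubic-path-reducible {u} {v} {w} u₃ v₃ w₃ vu vw u≢w = cubic-reducible {v} {u ∷ w ∷ []} (s≤s (s≤s z≤n))
          (λ { (here refl) → v₃ ; (there (here refl)) → u₃ ; (there (there (here refl))) → w₃ })
          (λ { (here refl) → u , there (here refl) , vu
             ; (there (here refl)) → v , here refl , Adj-sym vu
             ; (there (there (here refl))) → v , here refl , Adj-sym vw })
          (λ { (here refl) (here refl) (_ , _ , _ , v≢v , _) → contradiction refl v≢v
             ; (here refl) (there (here refl)) _ → inj₂ (w , there (there (here refl)) , vw , ≢-sym u≢w)
             ; (here refl) (there (there (here refl))) _ → inj₂ (u , there (here refl) , vu , u≢w)
             ; (there (here refl)) (here refl) _ → inj₁ (w , there (there (here refl)) , vw , ≢-sym u≢w)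
             ; (there (here refl)) (there (here refl)) (_ , _ , _ , u≢u , _) → contradiction refl u≢u
             ; (there (here refl)) (there (there (here refl))) _ → inj₁ (v , here refl , Adj-sym vw , Adj⇒≢ vu)
             ; (there (there (here refl))) (here refl) _ → inj₁ (u , there (here refl) , vu , u≢w)
             ; (there (there (here refl))) (there (here refl)) _ → inj₁ (v , here refl , Adj-sym vu , Adj⇒≢ vw)
             ; (there (there (here refl))) (there (there (here refl))) (_ , _ , _ , w≢w , _) → contradiction refl w≢w })

        module _ {x P} (x∈S : x ∈ˢ S) (un : Unique P) (bounded : length P ≤ 4)
                 (cubic : ∀ {s} → s ∈ P → Degree S 3 s) (joined : ∀ {s} → s ∈ P → Adj x s)
                 (few : deg S x ≤ 2 + length P)
                 (free : ∀ {s} → s ∈ P → ¬ Demanded S x s)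
                 (pair : ∀ {s t} → s ∈ P → t ∈ P → Demanded S s t → deg S x ≤ 1 + length P) where

          private
            P⊆nbrs : P ⊆ nbrs S x
            P⊆nbrs s∈ = nbrs-intro {S} (proj₁ (cubic s∈)) (joined s∈)

            x∉P : x ∉ P
            x∉P x∈P = Adj⇒≢ (joined x∈P) refl

            spoke-room : ∀ {s U} → s ∈ P → x ∈ U → deg (S ∖ U) s ≤ 2
            spoke-room s∈ x∈U = room₁ 2 x x∈U x∈S (Adj-sym (joined s∈)) (≤-reflexive (proj₂ (cubic s∈)))

            star-leads : ∀ {u} → u ∈ x ∷ P → Leads (x ∷ P) u
            star-leads (here refl) = leads P (λ z → z) (λ z → z) x∉P
              (room 2 P un there P⊆nbrs few) (cubic-orderly cubic)
            star-leads {s} (there s∈) = leads (x ∷ P′)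
              (λ { (here refl) → there (here refl) ; (there t∈) → reorder (⊆-without s P t∈) })
              (λ { (here refl) → there s∈ ; (there (here refl)) → here refl ; (there (there t∈)) → there (proj₁ (without-∈ P t∈)) })
              (λ { (here refl) → x∉P s∈ ; (there s∈′) → proj₂ (without-∈ P s∈′) refl })
              (spoke-room s∈ (there (here refl)))
              (room 3 P′ (without-unique un) there (P⊆nbrs ∘ proj₁ ∘ without-∈ P)
                 (≤-trans few (s≤s (s≤s (length-without s un))))
               ∷ cubic-orderly (cubic ∘ proj₁ ∘ without-∈ P))
              where
              P′ = without s P
              reorder : ∀ {t} → t ∈ s ∷ P′ → t ∈ s ∷ x ∷ P′
              reorder (here t≡s) = here t≡s
              reorder (there t∈) = there (there t∈)

            spoke-pair : ∀ {s t} → s ∈ P → t ∈ P → s ≢ t → deg S x ≤ 1 + length P → LeadsPair (x ∷ P) s t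
            spoke-pair {s} {t} s∈ t∈ s≢t few′ = leads (x ∷ P″)
              (λ { (here refl) → there (there (here refl)) ; (there r∈) → reorder (⊆-without s P r∈) })
              (λ { (here refl) → there s∈ ; (there (here refl)) → there t∈ ; (there (there (here refl))) → here refl
                 ; (there (there (there r∈))) → there (proj₁ (P″⊆ r∈)) })
              (λ { (here s≡t) → s≢t s≡t ; (there (here refl)) → x∉P s∈ ; (there (there s∈′)) → proj₁ (proj₂ (P″⊆ s∈′)) refl })
              (λ { (here refl) → x∉P t∈ ; (there t∈′) → proj₂ (proj₂ (P″⊆ t∈′)) refl })
              (spoke-room s∈ (there (there (here refl))))
              (spoke-room t∈ (there (here refl)))
              (room 3 P″ (without-unique (without-unique un)) there (P⊆nbrs ∘ proj₁ ∘ P″⊆)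
                 (≤-trans few′ (s≤s (≤-trans (length-without s un) (s≤s (length-without t (without-unique un))))))
               ∷ cubic-orderly (cubic ∘ proj₁ ∘ P″⊆))
              where
              P″ = without t (without s P)
              P″⊆ : ∀ {r} → r ∈ P″ → r ∈ P × r ≢ s × r ≢ t
              P″⊆ r∈ with without-∈ (without s P) r∈
              ... | r∈′ , r≢t with without-∈ P r∈′
              ... | r∈″ , r≢s = r∈″ , r≢s , r≢t
              reorder : ∀ {r} → r ∈ s ∷ without s P → r ∈ s ∷ t ∷ x ∷ P″
              reorder (here r≡s) = here r≡s
              reorder (there r∈) with ⊆-without t (without s P) r∈
              ... | here r≡t  = there (here r≡t)
              ... | there r∈′ = there (there (there r∈′))

          -- The centre `x` is coloured first or directly after the spokes to be controlled. By
          -- `few` it sees at most two coloured neighbours when it starts and at most three after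
          -- one spoke. A second spoke ahead of it costs one more, which is why `pair` asks for a
          -- sharper bound, but only if a pair of spokes is demanded.
          star-reducible : Reducible S
          star-reducible = reducible x P bounded (λ { (here refl) → x∈S ; (there s∈) → proj₁ (cubic s∈) }) star-leads
            (λ { (here refl) (here refl) (_ , _ , _ , x≢x , _) → contradiction refl x≢x
               ; (here refl) (there t∈) dem → contradiction dem (free t∈)
               ; (there s∈) (here refl) dem → contradiction (Demanded-sym {S} dem) (free s∈)
               ; (there s∈) (there t∈) dem@(_ , _ , _ , s≢t , _) → pair-avoidable (spoke-pair s∈ t∈ s≢t (pair s∈ t∈ dem)) })

        -- Two adjacent 3-vertices with two common neighbours of degree 4.

        module _ {a b x y} (a₃ : Degree S 3 a) (b₃ : Degree S 3 b)
                 (x₄ : Degree S 4 x) (y₄ : Degree S 4 y) (x≢y : x ≢ y)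
                 (ab : Adj a b) (ax : Adj a x) (ay : Adj a y) (bx : Adj b x) (by : Adj b y)
                 (free-xa : ¬ Demanded S x a) (free-xb : ¬ Demanded S x b)
                 (free-ya : ¬ Demanded S y a) (free-yb : ¬ Demanded S y b) where

          private
            H : List (Fin n)
            H = a ∷ b ∷ x ∷ y ∷ []

            a≢b : a ≢ b
            a≢b = Adj⇒≢ ab
            a≢x : a ≢ x
            a≢x = Adj⇒≢ ax
            a≢y : a ≢ y
            a≢y = Adj⇒≢ ay
            b≢x : b ≢ x
            b≢x = Adj⇒≢ bx
            b≢y : b ≢ y
            b≢y = Adj⇒≢ by

            nbrs-a : nbrs S a ⊆ b ∷ x ∷ y ∷ []
            nbrs-a = exhausts (unique₃ b≢x b≢y x≢y)
              (λ { (here refl) → nbrs-intro {S} (proj₁ b₃) ab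
                 ; (there (here refl)) → nbrs-intro {S} (proj₁ x₄) ax
                 ; (there (there (here refl))) → nbrs-intro {S} (proj₁ y₄) ay })
              (≤-reflexive (proj₂ a₃))

            Allowed : Coloring → Fin n → Fin 4 → Set
            Allowed ψ v i = ∀ {z} → z ∈ˢ S ∖ H → Adj v z → colour ψ z ≢ lookup (L v) i

            -- Then a keeps a colour other than c and p, q (the colours of x, y) whatever the colour of b.
            Covered : ℕ → ℕ → ℕ → Set
            Covered c p q = ∃ λ e → ∃ λ e′ → ∀ i → lookup (L a) i ≢ e → lookup (L a) i ≢ e′ →
              lookup (L a) i ≢ c × lookup (L a) i ≢ p × lookup (L a) i ≢ q

            -- The order is `x`, `y`, `b`, `a`. At its turn `b` has at most two coloured neighbours
            -- and can avoid `c` as well. Then `a` faces `c` and the colours of `b`, `x`, `y`, four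
            -- conditions on four colours; `Covered` replaces the three not coming from `b` by two.
            avoid : ∀ {ψ} c i j → Proper (S ∖ H) ψ → Allowed ψ x i → Allowed ψ y j →
                    (Adj x y → lookup (L x) i ≢ lookup (L y) j) → Covered c (lookup (L x) i) (lookup (L y) j) →
                    Avoiding S H ψ a b c
            avoid {ψ} c i j proper-ψ allowed-x allowed-y apart (e , e′ , covered)
              with allowed-avoiding (S ∖ (b ∷ a ∷ [])) b (ψ [ x ≔ i ] [ y ≔ j ]) [ c ]
                     (+-monoˡ-≤ 1 (room₁ {b ∷ a ∷ []} {b} 2 a (there (here refl)) (proj₁ a₃) (Adj-sym ab) (≤-reflexive (proj₂ b₃))))
            ... | k , allowed-b , k∉
              with pick a (e ∷ e′ ∷ lookup (L b) k ∷ []) ≤-refl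
            ... | l , l∉ =
              extension φ₄
                (λ {v} v∉ → trans (update-≢ φ₃ a l {v} (λ { refl → v∉ (here refl) }))
                           (trans (update-≢ φ₂ b k {v} (λ { refl → v∉ (there (here refl)) }))
                           (trans (update-≢ φ₁ y j {v} (λ { refl → v∉ (there (there (there (here refl)))) }))
                                  (update-≢ ψ x i {v} (λ { refl → v∉ (there (there (here refl))) })))))
                (λ u∈ v∈ → proper₄ (∖-intro {S = S} {[]} u∈ (λ ())) (∖-intro {S = S} {[]} v∈ (λ ())))
              , (λ eq → proj₁ covered-l (trans (cong (lookup (L a)) (≡-sym (update-≡ φ₃ a l))) eq))
              , (λ eq → k∉ (here (trans (cong (lookup (L b)) (≡-sym φ₄b)) eq)))
              where
              φ₁ φ₂ φ₃ φ₄ : Coloring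
              φ₁ = ψ [ x ≔ i ]
              φ₂ = φ₁ [ y ≔ j ]
              φ₃ = φ₂ [ b ≔ k ]
              φ₄ = φ₃ [ a ≔ l ]
              covered-l = covered l (l∉ ∘ here) (l∉ ∘ there ∘ here)
              φ₄b : φ₄ b ≡ k
              φ₄b = trans (update-≢ φ₃ a l (≢-sym a≢b)) (update-≡ φ₂ b k)
              φ₃x : φ₃ x ≡ i
              φ₃x = trans (update-≢ φ₂ b k (≢-sym b≢x))
                   (trans (update-≢ φ₁ y j x≢y) (update-≡ ψ x i))
              φ₃y : φ₃ y ≡ j
              φ₃y = trans (update-≢ φ₂ b k (≢-sym b≢y)) (update-≡ φ₁ y j)
              H⊆ : H ⊆ x ∷ y ∷ b ∷ a ∷ []
              H⊆ (here z) = there (there (there (here z)))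
              H⊆ (there (here z)) = there (there (here z))
              H⊆ (there (there (here z))) = here z
              H⊆ (there (there (there (here z)))) = there (here z)
              proper₁ : Proper (S ∖ (y ∷ b ∷ a ∷ [])) φ₁
              proper₁ = proper-update {S} i (proper-∖ {S} H⊆ proper-ψ)
                          (λ z∈ → allowed-x (∖-mono {S = S} H⊆ z∈))
              proper₂ : Proper (S ∖ (b ∷ a ∷ [])) φ₂
              proper₂ = proper-update {S} j proper₁ allowed
                where
                allowed : ∀ {z} → z ∈ˢ S ∖ (y ∷ b ∷ a ∷ []) → Adj y z → colour φ₁ z ≢ lookup (L y) j
                allowed {z} z∈ yz eq with z ≟ x
                ... | yes refl = apart (Adj-sym yz) eq
                ... | no z≢x   = allowed-y (∖-mono {S = S} H⊆ (∖-cons {S = S} z∈ z≢x)) yz eq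
              proper₃ : Proper (S ∖ [ a ]) φ₃
              proper₃ = proper-update {S} k proper₂ allowed-b
              proper₄ : Proper (S ∖ []) φ₄
              proper₄ = proper-update {S} l proper₃ allowed
                where
                allowed : ∀ {z} → z ∈ˢ S ∖ [ a ] → Adj a z → colour φ₃ z ≢ lookup (L a) l
                allowed z∈ az eq with nbrs-a (nbrs-intro {S} (proj₁ (∖-elim {S = S} {[ a ]} z∈)) az)
                ... | here refl = l∉ (there (there (here (trans (≡-sym eq) (cong (lookup (L b)) (update-≡ φ₂ b k))))))
                ... | there (here refl) = proj₁ (proj₂ covered-l) (trans (≡-sym eq) (cong (lookup (L x)) φ₃x))
                ... | there (there (here refl)) = proj₂ (proj₂ covered-l) (trans (≡-sym eq) (cong (lookup (L y)) φ₃y))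

            -- A colour for `x` or `y` that costs `a` nothing once `a` avoids `c`.
            Harmless : ℕ → ℕ → Set
            Harmless c p = p ∉ palette a ⊎ p ≡ c

            harmless? : ∀ c p → Dec (Harmless c p)
            harmless? c p = ¬? (DecMembership._∈?_ ℕ._≟_ p (palette a)) ⊎-dec (p ℕ.≟ c)

            spared : ∀ {c p} i → Harmless c p → lookup (L a) i ≢ c → lookup (L a) i ≢ p
            spared i (inj₁ p∉)   ≢c refl = p∉ (∈-palette a i)
            spared i (inj₂ refl) ≢c eq   = ≢c eq

            covered-left : ∀ {c p q} → Harmless c p → Covered c p q
            covered-left {c} {p} {q} harmless = c , q , λ i ≢c ≢q → ≢c , spared i harmless ≢c , ≢q

            covered-right : ∀ {c p q} → Harmless c q → Covered c p q
            covered-right {c} {p} {q} harmless = c , p , λ i ≢c ≢p → ≢c , ≢p , spared i harmless ≢c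

            covered-same : ∀ {c p q} → p ≡ q → Covered c p q
            covered-same {c} {p} refl = c , p , λ i ≢c ≢p → ≢c , ≢p , ≢p

            harmful : ∀ {c p} → ¬ Harmless c p → p ∈ palette a × c ≢ p
            harmful {c} {p} ¬harmless =
              decidable-stable (DecMembership._∈?_ ℕ._≟_ p _) (¬harmless ∘ inj₁) , (λ c≡p → ¬harmless (inj₂ (≡-sym c≡p)))

            rest-x : deg (S ∖ H) x ≤ 2
            rest-x = room₂ 2 a b a≢b (here refl) (there (here refl)) (proj₁ a₃) (proj₁ b₃)
                       (Adj-sym ax) (Adj-sym bx) (≤-reflexive (proj₂ x₄))

            rest-y : deg (S ∖ H) y ≤ 2
            rest-y = room₂ 2 a b a≢b (here refl) (there (here refl)) (proj₁ a₃) (proj₁ b₃)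
                       (Adj-sym ay) (Adj-sym by) (≤-reflexive (proj₂ y₄))

            rest₁ : ∀ {v t} → Degree S 4 v → Degree S 4 t → t ∈ H →
                    Adj a v → Adj b v → Adj v t → a ≢ t → b ≢ t → deg (S ∖ H) v ≤ 1
            rest₁ {v} {t} v₄ t₄ t∈H av bv vt a≢t b≢t =
              room 1 (a ∷ b ∷ t ∷ []) (unique₃ a≢b a≢t b≢t)
                (λ { (here refl) → here refl ; (there (here refl)) → there (here refl) ; (there (there (here refl))) → t∈H })
                (λ { (here refl) → nbrs-intro {S} (proj₁ a₃) (Adj-sym av)
                   ; (there (here refl)) → nbrs-intro {S} (proj₁ b₃) (Adj-sym bv)
                   ; (there (there (here refl))) → nbrs-intro {S} (proj₁ t₄) vt })
                (≤-reflexive (proj₂ v₄))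

            too-many : ∀ {c ps} → length ps ≡ 4 → Unique ps → c ∈ palette a →
                       (∀ {p} → p ∈ ps → p ∈ palette a × c ≢ p) → ∀ {A : Set} → A
            too-many {c} {ps} |ps| un c∈ all∈ = contradiction
              (length-⊆ {xs = c ∷ ps} (All.tabulate (proj₂ ∘ all∈) ∷ un)
                (λ { (here refl) → c∈ ; (there p∈) → proj₁ (all∈ p∈) }))
              (<⇒≱ (s≤s (≤-reflexive (≡-sym |ps|))))

            -- Each of `x`, `y` has two free colours. A harmless one, or one common to both
            -- vertices, makes `Covered` hold; otherwise the four and `c` are five distinct colours
            -- in the list of `a`.
            decide : ∀ {ψ} c → c ∈ palette a → ¬ Adj x y → Proper (S ∖ H) ψ →
                     ∀ {i i′ j j′} → Allowed ψ x i → Allowed ψ x i′ → Allowed ψ y j → Allowed ψ y j′ →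
                     lookup (L x) i ≢ lookup (L x) i′ → lookup (L y) j ≢ lookup (L y) j′ →
                     Avoiding S H ψ a b c
            decide c c∈ ¬xy proper {i} {i′} {j} {j′} i-ok i′-ok j-ok j′-ok p≢p′ q≢q′ =
              by-harm (harmless? c p) (harmless? c p′) (harmless? c q) (harmless? c q′)
              where
              p  = lookup (L x) i
              p′ = lookup (L x) i′
              q  = lookup (L y) j
              q′ = lookup (L y) j′
              apart : ∀ {A : Set} → Adj x y → A
              apart xy = contradiction xy ¬xy
              by-equality : ¬ Harmless c p → ¬ Harmless c p′ → ¬ Harmless c q → ¬ Harmless c q′ →
                            Dec (p ≡ q) → Dec (p ≡ q′) → Dec (p′ ≡ q) → Dec (p′ ≡ q′) → Avoiding S H _ a b c
              by-equality hp hp′ hq hq′ (yes e) _ _ _ = avoid c i j proper i-ok j-ok apart (covered-same e)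
              by-equality hp hp′ hq hq′ (no _) (yes e) _ _ = avoid c i j′ proper i-ok j′-ok apart (covered-same e)
              by-equality hp hp′ hq hq′ (no _) (no _) (yes e) _ = avoid c i′ j proper i′-ok j-ok apart (covered-same e)
              by-equality hp hp′ hq hq′ (no _) (no _) (no _) (yes e) = avoid c i′ j′ proper i′-ok j′-ok apart (covered-same e)
              by-equality hp hp′ hq hq′ (no p≢q) (no p≢q′) (no p′≢q) (no p′≢q′) = too-many {ps = p ∷ p′ ∷ q ∷ q′ ∷ []} refl
                ((p≢p′ ∷ p≢q ∷ p≢q′ ∷ []) ∷ (p′≢q ∷ p′≢q′ ∷ []) ∷ (q≢q′ ∷ []) ∷ [] ∷ [])
                c∈
                (λ { (here refl) → harmful hp ; (there (here refl)) → harmful hp′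
                   ; (there (there (here refl))) → harmful hq ; (there (there (there (here refl)))) → harmful hq′ })
              by-harm : Dec (Harmless c p) → Dec (Harmless c p′) → Dec (Harmless c q) → Dec (Harmless c q′) →
                        Avoiding S H _ a b c
              by-harm (yes h) _ _ _ = avoid c i j proper i-ok j-ok apart (covered-left h)
              by-harm (no _) (yes h) _ _ = avoid c i′ j proper i′-ok j-ok apart (covered-left h)
              by-harm (no _) (no _) (yes h) _ = avoid c i j proper i-ok j-ok apart (covered-right h)
              by-harm (no _) (no _) (no _) (yes h) = avoid c i j′ proper i-ok j′-ok apart (covered-right h)
              by-harm (no hp) (no hp′) (no hq) (no hq′) =
                by-equality hp hp′ hq hq′ (p ℕ.≟ q) (p ℕ.≟ q′) (p′ ℕ.≟ q) (p′ ℕ.≟ q′)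

            avoid-independent : ∀ {ψ} c → c ∈ palette a → ¬ Adj x y → Proper (S ∖ H) ψ →
                                Avoiding S H ψ a b c
            avoid-independent {ψ} c c∈ ¬xy proper =
              let (i  , i-ok  , _)   = allowed-avoiding (S ∖ H) x ψ [] (+-mono-≤ rest-x z≤n)
                  (j  , j-ok  , _)   = allowed-avoiding (S ∖ H) y ψ [] (+-mono-≤ rest-y z≤n)
                  (i′ , i′-ok , i′∉) = allowed-avoiding (S ∖ H) x ψ [ lookup (L x) i ] (+-monoˡ-≤ 1 rest-x)
                  (j′ , j′-ok , j′∉) = allowed-avoiding (S ∖ H) y ψ [ lookup (L y) j ] (+-monoˡ-≤ 1 rest-y)
              in decide c c∈ ¬xy proper i-ok i′-ok j-ok j′-ok (λ e → i′∉ (here (≡-sym e))) (λ e → j′∉ (here (≡-sym e)))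

            avoid-after-x : ∀ {ψ} c i → Proper (S ∖ H) ψ → Allowed ψ x i →
                            (∀ {q} → Covered c (lookup (L x) i) q) → Avoiding S H ψ a b c
            avoid-after-x {ψ} c i proper allowed covered =
              let (j , j-ok , j∉) = allowed-avoiding (S ∖ H) y ψ [ lookup (L x) i ] (+-monoˡ-≤ 1 rest-y) in
              avoid c i j proper allowed j-ok (λ _ eq → j∉ (here (≡-sym eq))) covered

            -- Now the colours of `x` and `y` must differ, so they cannot be chosen independently.
            -- Among the four colours of `x` one is harmless, since otherwise they and `c` would be
            -- five distinct colours in the list of `a`. It is fixed by `c`, whatever `ψ` is. With
            -- `a`, `b`, `y` inside `H`, at most one outer neighbour `z` of `x` can block it, which
            -- yields the second alternative.
            avoid-K₄ : ∀ c → c ∈ palette a → Adj x y →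
              (∀ {ψ} → Proper (S ∖ H) ψ → Avoiding S H ψ a b c) ⊎
              (∃ λ z → ∃ λ g → z ∈ˢ S ∖ H ×
                (∀ {ψ} → Proper (S ∖ H) ψ → colour ψ z ≢ g → Avoiding S H ψ a b c))
            avoid-K₄ c c∈ xy with any? (λ k → harmless? c (lookup (L x) k))
            ... | no none = too-many {ps = palette x} refl (palette-unique x) c∈ λ p∈ → harmful λ h →
                    let (k , _ , eq) = ∈-map⁻ (lookup (L x)) p∈ in none (k , subst (Harmless c) eq h)
            ... | yes (k , harmless) = by-nbrs (nbrs (S ∖ H) x) refl
              where
              with-x : ∀ {ψ} → Proper (S ∖ H) ψ → Allowed ψ x k → Avoiding S H ψ a b c
              with-x proper allowed = avoid-after-x c k proper allowed (covered-left harmless)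
              by-nbrs : ∀ zs → nbrs (S ∖ H) x ≡ zs →
                (∀ {ψ} → Proper (S ∖ H) ψ → Avoiding S H ψ a b c) ⊎
                (∃ λ z → ∃ λ g → z ∈ˢ S ∖ H ×
                  (∀ {ψ} → Proper (S ∖ H) ψ → colour ψ z ≢ g → Avoiding S H ψ a b c))
              by-nbrs [] eq = inj₁ λ proper → with-x proper λ z∈ xz → contradiction (subst (_ ∈_) eq (nbrs-intro {S ∖ H} z∈ xz)) λ ()
              by-nbrs (z ∷ []) eq = inj₂ (z , lookup (L x) k , proj₁ (nbrs-elim {S ∖ H} (subst (z ∈_) (≡-sym eq) (here refl))) ,
                λ proper z≢ → with-x proper λ z′∈ xz′ → allowed z≢ (subst (_ ∈_) eq (nbrs-intro {S ∖ H} z′∈ xz′)))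
                where
                allowed : ∀ {ψ} → colour ψ z ≢ lookup (L x) k → ∀ {z′} → z′ ∈ [ z ] → colour ψ z′ ≢ lookup (L x) k
                allowed z≢ (here refl) = z≢
              by-nbrs (z ∷ z′ ∷ zs) eq = contradiction
                (subst (_≤ 1) (cong length eq) (rest₁ x₄ y₄ (there (there (there (here refl)))) ax bx xy a≢y b≢y)) λ { (s≤s ()) }

            avoid-ab : PairAvoidable H a b
            avoid-ab c with DecMembership._∈?_ ℕ._≟_ c (palette a) | adj G x y Bool.≟ true
            ... | yes c∈ | yes xy = avoid-K₄ c c∈ xy
            ... | yes c∈ | no ¬xy = inj₁ (avoid-independent c c∈ ¬xy)
            -- The colour `c` is absent from the list of `a`, so only the colours of `x` and `y`
            -- remain to be covered.
            ... | no c∉  | _      = inj₁ λ {ψ} proper → easy {ψ} proper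
              where
              covered : ∀ {p q} → Covered c p q
              covered {p} {q} = p , q , λ k ≢p ≢q → (λ eq → c∉ (subst (_∈ _) eq (∈-palette a k))) , ≢p , ≢q
              easy : ∀ {ψ} → Proper (S ∖ H) ψ → Avoiding S H ψ a b c
              easy {ψ} proper =
                let (i , i-ok , _)  = allowed-avoiding (S ∖ H) x ψ [] (+-mono-≤ rest-x z≤n)
                in avoid-after-x c i proper i-ok covered

            cubic-tail : ∀ {u} → Degree S 3 u → Orderly S [ u ]
            cubic-tail u₃ = cubic-orderly (λ { (here refl) → u₃ })

            ba-orderly : Orderly S (a ∷ b ∷ [])
            ba-orderly = cubic-orderly (λ { (here refl) → a₃ ; (there (here refl)) → b₃ })

            lead : ∀ {u} → u ∈ H → Leads H u
            lead (here refl) = leads (x ∷ y ∷ b ∷ [])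
              (λ { (here z) → here z ; (there (here z)) → there (there (there (here z)))
                 ; (there (there (here z))) → there (here z) ; (there (there (there (here z)))) → there (there (here z)) })
              (λ { (here z) → here z ; (there (here z)) → there (there (here z))
                 ; (there (there (here z))) → there (there (there (here z))) ; (there (there (there (here z)))) → there (here z) })
              (λ { (here z) → a≢x z ; (there (here z)) → a≢y z ; (there (there (here z))) → a≢b z })
              (room₁ 2 x (there (here refl)) (proj₁ x₄) ax (≤-reflexive (proj₂ a₃)))
              (room₁ 3 b (there (there (here refl))) (proj₁ b₃) (Adj-sym bx) (≤-reflexive (proj₂ x₄))
               ∷ room₁ 3 b (there (here refl)) (proj₁ b₃) (Adj-sym by) (≤-reflexive (proj₂ y₄))
               ∷ cubic-tail b₃)
            lead (there (here refl)) = leads (x ∷ y ∷ a ∷ [])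
              (λ { (here z) → there (there (there (here z))) ; (there (here z)) → here z
                 ; (there (there (here z))) → there (here z) ; (there (there (there (here z)))) → there (there (here z)) })
              (λ { (here z) → there (here z) ; (there (here z)) → there (there (here z))
                 ; (there (there (here z))) → there (there (there (here z))) ; (there (there (there (here z)))) → here z })
              (λ { (here z) → b≢x z ; (there (here z)) → b≢y z ; (there (there (here z))) → a≢b (≡-sym z) })
              (room₁ 2 x (there (here refl)) (proj₁ x₄) bx (≤-reflexive (proj₂ b₃)))
              (room₁ 3 a (there (there (here refl))) (proj₁ a₃) (Adj-sym ax) (≤-reflexive (proj₂ x₄))
               ∷ room₁ 3 a (there (here refl)) (proj₁ a₃) (Adj-sym ay) (≤-reflexive (proj₂ y₄))
               ∷ cubic-tail a₃)
            lead (there (there (here refl))) = leads (y ∷ a ∷ b ∷ [])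
              (λ { (here z) → there (there (here z)) ; (there (here z)) → there (there (there (here z)))
                 ; (there (there (here z))) → here z ; (there (there (there (here z)))) → there (here z) })
              (λ { (here z) → there (there (here z)) ; (there (here z)) → there (there (there (here z)))
                 ; (there (there (here z))) → here z ; (there (there (there (here z)))) → there (here z) })
              (λ { (here z) → x≢y z ; (there (here z)) → a≢x (≡-sym z) ; (there (there (here z))) → b≢x (≡-sym z) })
              (room₂ 2 a b a≢b (there (there (here refl))) (there (there (there (here refl)))) (proj₁ a₃) (proj₁ b₃)
                 (Adj-sym ax) (Adj-sym bx) (≤-reflexive (proj₂ x₄)))
              (room₁ 3 a (there (here refl)) (proj₁ a₃) (Adj-sym ay) (≤-reflexive (proj₂ y₄)) ∷ ba-orderly)
            lead (there (there (there (here refl)))) = leads (x ∷ a ∷ b ∷ [])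
              (λ { (here z) → there (there (here z)) ; (there (here z)) → there (there (there (here z)))
                 ; (there (there (here z))) → there (here z) ; (there (there (there (here z)))) → here z })
              (λ { (here z) → there (there (there (here z))) ; (there (here z)) → there (there (here z))
                 ; (there (there (here z))) → here z ; (there (there (there (here z)))) → there (here z) })
              (λ { (here z) → x≢y (≡-sym z) ; (there (here z)) → a≢y (≡-sym z) ; (there (there (here z))) → b≢y (≡-sym z) })
              (room₂ 2 a b a≢b (there (there (here refl))) (there (there (there (here refl)))) (proj₁ a₃) (proj₁ b₃)
                 (Adj-sym ay) (Adj-sym by) (≤-reflexive (proj₂ y₄)))
              (room₁ 3 a (there (here refl)) (proj₁ a₃) (Adj-sym ax) (≤-reflexive (proj₂ x₄)) ∷ ba-orderly)

            -- With `a` and `b` left to the end, `x` and `y` have at most two coloured neighbours at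
            -- their turns, even if they are adjacent.
            avoid-xy : PairAvoidable H x y
            avoid-xy = pair-avoidable {H} {x} {y} (leads (a ∷ b ∷ [])
              (λ { (here z) → there (there (here z)) ; (there (here z)) → there (there (there (here z)))
                 ; (there (there (here z))) → here z ; (there (there (there (here z)))) → there (here z) })
              (λ { (here z) → there (there (here z)) ; (there (here z)) → there (there (there (here z)))
                 ; (there (there (here z))) → here z ; (there (there (there (here z)))) → there (here z) })
              (λ { (here z) → x≢y z ; (there (here z)) → a≢x (≡-sym z) ; (there (there (here z))) → b≢x (≡-sym z) })
              (λ { (here z) → a≢y (≡-sym z) ; (there (here z)) → b≢y (≡-sym z) })
              (room₂ 2 a b a≢b (there (there (here refl))) (there (there (there (here refl)))) (proj₁ a₃) (proj₁ b₃)
                 (Adj-sym ax) (Adj-sym bx) (≤-reflexive (proj₂ x₄)))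
              (room₂ 2 a b a≢b (there (here refl)) (there (there (here refl))) (proj₁ a₃) (proj₁ b₃)
                 (Adj-sym ay) (Adj-sym by) (≤-reflexive (proj₂ y₄)))
              ba-orderly)

            pair : ∀ {u v} → u ∈ H → v ∈ H → Demanded S u v → PairAvoidable H u v
            pair (here refl) (there (here refl)) _ = avoid-ab
            pair (there (here refl)) (here refl) _ = pair-avoidable-sym avoid-ab
            pair (there (there (here refl))) (there (there (there (here refl)))) _ = avoid-xy
            pair (there (there (there (here refl)))) (there (there (here refl))) _ = pair-avoidable-sym avoid-xy
            pair (here refl) (there (there (here refl))) dem = contradiction (Demanded-sym {S} dem) free-xa
            pair (here refl) (there (there (there (here refl)))) dem = contradiction (Demanded-sym {S} dem) free-ya
            pair (there (here refl)) (there (there (here refl))) dem = contradiction (Demanded-sym {S} dem) free-xb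
            pair (there (here refl)) (there (there (there (here refl)))) dem = contradiction (Demanded-sym {S} dem) free-yb
            pair (there (there (here refl))) (here refl) dem = contradiction dem free-xa
            pair (there (there (here refl))) (there (here refl)) dem = contradiction dem free-xb
            pair (there (there (there (here refl)))) (here refl) dem = contradiction dem free-ya
            pair (there (there (there (here refl)))) (there (here refl)) dem = contradiction dem free-yb
            pair (here refl) (here refl) (_ , _ , _ , ≢ , _) = contradiction refl ≢
            pair (there (here refl)) (there (here refl)) (_ , _ , _ , ≢ , _) = contradiction refl ≢
            pair (there (there (here refl))) (there (there (here refl))) (_ , _ , _ , ≢ , _) = contradiction refl ≢
            pair (there (there (there (here refl)))) (there (there (there (here refl)))) (_ , _ , _ , ≢ , _) = contradiction refl ≢

          diamond-reducible : Reducible S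
          diamond-reducible = reducible a (b ∷ x ∷ y ∷ []) (s≤s (s≤s (s≤s z≤n)))
            (λ { (here refl) → proj₁ a₃ ; (there (here refl)) → proj₁ b₃ ; (there (there (here refl))) → proj₁ x₄
               ; (there (there (there (here refl)))) → proj₁ y₄ })
            lead pair

        private
          decide : ∀ {A B : Set} → Dec A → (A → B) → (¬ A → B) → B
          decide (yes a) f g = f a
          decide (no ¬a) f g = g ¬a

        spokes-reducible : ∀ {x} P → x ∈ˢ S → Unique P → length P ≤ 4 → (∀ {s} → s ∈ P → Spoke S x s) →
                           deg S x ≤ 1 + length P → Reducible S
        spokes-reducible P x∈S un bounded spoke few = star-reducible x∈S un bounded
          (λ s∈ → proj₁ (proj₂ (spoke s∈))) (λ s∈ → proj₁ (proj₂ (proj₂ (spoke s∈)))) (≤-trans few (n≤1+n _))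
          (λ s∈ → proj₂ (proj₂ (proj₂ (spoke s∈)))) (λ _ _ _ → few)

        fork-reducible : ∀ {x s t} → deg S x ≡ 4 → Spoke S x s → Spoke S x t → s ≢ t → ¬ Demanded S s t →
                         Reducible S
        fork-reducible {x} {s} {t} d₄ ((x∈S , _) , s₃ , xs , free-s) (_ , t₃ , xt , free-t) s≢t free =
          star-reducible {P = s ∷ t ∷ []} x∈S (unique₂ s≢t) (s≤s (s≤s z≤n))
            (λ { (here refl) → s₃ ; (there (here refl)) → t₃ })
            (λ { (here refl) → xs ; (there (here refl)) → xt })
            (≤-reflexive d₄)
            (λ { (here refl) → free-s ; (there (here refl)) → free-t })
            (λ { (here refl) (here refl) (_ , _ , _ , ≢ , _) → contradiction refl ≢
               ; (here refl) (there (here refl)) dem → contradiction dem free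
               ; (there (here refl)) (here refl) dem → contradiction (Demanded-sym {S} dem) free
               ; (there (here refl)) (there (here refl)) (_ , _ , _ , ≢ , _) → contradiction refl ≢ })

        -- Only `k` of the spokes are taken: this keeps the configuration within five vertices, and
        -- `x` has at most one neighbour besides them.
        many-spokes-reducible : ∀ {x} k → k ≤ 4 → deg S x ≤ 1 + k → k ≤ length (spokes S x) → 1 ≤ k → Reducible S
        many-spokes-reducible {x} k k≤4 d≤ k≤ 1≤k = go (spokes S x) k≤ 1≤k (spokes-unique S x) (spokes-elim S)
          where
          go : ∀ ss → k ≤ length ss → 1 ≤ k → Unique ss → (∀ {s} → s ∈ ss → Spoke S x s) → Reducible S
          go ss k≤ 1≤k un spoke = spokes-reducible (take k ss) (x∈S ss k≤ 1≤k spoke) (Unique.take⁺ k un)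
            (≤-trans (≤-reflexive len) k≤4) (λ s∈ → spoke (take⊆ k ss s∈)) (≤-trans d≤ (s≤s (≤-reflexive (≡-sym len))))
            where
            len : length (take k ss) ≡ k
            len = trans (length-take k ss) (m≤n⇒m⊓n≡m k≤)
            take⊆ : ∀ k ss → take k ss ⊆ ss
            take⊆ (suc k) (s ∷ ss) (here eq) = here eq
            take⊆ (suc k) (s ∷ ss) (there s∈) = there (take⊆ k ss s∈)
            x∈S : ∀ ss → k ≤ length ss → 1 ≤ k → (∀ {s} → s ∈ ss → Spoke S x s) → x ∈ˢ S
            x∈S [] k≤ 1≤k _ = contradiction (≤-trans 1≤k k≤) λ ()
            x∈S (s ∷ ss) _ _ spoke = proj₁ (proj₁ (spoke (here refl)))

        -- All configurations are decidable. If the searches fail, their failures form an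
        -- `Irreducible`, and `irreducible-dense` contradicts `sparse`.
        reducible-exists : MadLt11/3 G → ∀ {v} → v ∈ˢ S → Reducible S
        reducible-exists mad {v} v∈S =
          decide (any? λ v → (v ∈ˢ? S) ×-dec (deg S v ≤? 2))
            (λ { (v , v∈ , d≤2) → low-degree-reducible v∈ d≤2 }) λ ¬low →
          decide (any? λ a → any? λ b → Degree? S 3 a ×-dec Degree? S 3 b ×-dec (adj G a b Bool.≟ true) ×-dec ¬? (Demanded? S a b))
            (λ { (a , b , a₃ , b₃ , ab , free) → cubic-edge-reducible a₃ b₃ ab free }) λ ¬edge →
          decide (any? λ u → any? λ v → any? λ w → Degree? S 3 u ×-dec Degree? S 3 v ×-dec Degree? S 3 w
                    ×-dec (adj G v u Bool.≟ true) ×-dec (adj G v w Bool.≟ true) ×-dec ¬? (u ≟ w))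
            (λ { (u , v , w , u₃ , v₃ , w₃ , vu , vw , u≢w) → cubic-path-reducible u₃ v₃ w₃ vu vw u≢w }) λ ¬path →
          decide (any? λ x → any? λ s → any? λ t → (deg S x ℕ.≟ 4) ×-dec Spoke? S x s ×-dec Spoke? S x t
                    ×-dec ¬? (s ≟ t) ×-dec ¬? (Demanded? S s t))
            (λ { (x , s , t , d₄ , xs , xt , s≢t , free) → fork-reducible d₄ xs xt s≢t free }) λ ¬fork →
          decide (any? λ x → (deg S x ℕ.≟ 4) ×-dec (3 ≤? length (spokes S x)))
            (λ { (x , d₄ , 3≤) → many-spokes-reducible 3 (n≤1+n 3) (≤-reflexive d₄) 3≤ (s≤s z≤n) }) λ ¬spokes₄ →
          decide (any? λ x → (deg S x ℕ.≟ 5) ×-dec (4 ≤? length (spokes S x)))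
            (λ { (x , d₅ , 4≤) → many-spokes-reducible 4 ≤-refl (≤-reflexive d₅) 4≤ (s≤s z≤n) }) λ ¬spokes₅ →
          decide (any? λ a → any? λ b → any? λ x → any? λ y → (adj G a b Bool.≟ true) ×-dec ¬? (x ≟ y)
                    ×-dec (deg S x ℕ.≟ 4) ×-dec (deg S y ℕ.≟ 4)
                    ×-dec Spoke? S x a ×-dec Spoke? S x b ×-dec Spoke? S y a ×-dec Spoke? S y b)
            (λ { (a , b , x , y , ab , x≢y , d₄ , d₄′ ,
                  ((x∈ , _) , a₃ , xa , free-xa) , (_ , b₃ , xb , free-xb) , ((y∈ , _) , _ , ya , free-ya) , (_ , _ , yb , free-yb)) →
                 diamond-reducible a₃ b₃ (x∈ , d₄) (y∈ , d₄′) x≢y ab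
                   (Adj-sym xa) (Adj-sym ya) (Adj-sym xb) (Adj-sym yb) free-xa free-xb free-ya free-yb }) λ ¬diamond →
          contradiction (sparse S mad v∈S) (≤⇒≯ (irreducible-dense S record
            { low     = λ {v} v∈ → ≰⇒> (λ d≤2 → ¬low (v , v∈ , d≤2))
            ; edge    = λ {a} {b} a₃ b₃ ab → decidable-stable (Demanded? S a b) (λ free → ¬edge (a , b , a₃ , b₃ , ab , free))
            ; path    = λ {u} {v} {w} u₃ v₃ w₃ vu vw → decidable-stable (u ≟ w) (λ u≢w → ¬path (u , v , w , u₃ , v₃ , w₃ , vu , vw , u≢w))
            ; fork    = λ {x} {s} {t} d₄ xs xt s≢t →
                          decidable-stable (Demanded? S s t) (λ free → ¬fork (x , s , t , d₄ , xs , xt , s≢t , free))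
            ; spokes₄ = λ {x} d₄ → ≮⇒≥ (λ 3≤ → ¬spokes₄ (x , d₄ , 3≤))
            ; spokes₅ = λ {x} d₅ → ≮⇒≥ (λ 4≤ → ¬spokes₅ (x , d₅ , 4≤))
            ; diamond = λ {a} {b} {x} {y} ab x≢y d₄ d₄′ xa xb ya yb →
                          contradiction (a , b , x , y , ab , x≢y , d₄ , d₄′ , xa , xb , ya , yb) ¬diamond
            }))

      -- Multisets of colourings, grown by undoing the reductions.

      ProperColoring : VertexSet → Set
      ProperColoring S = Σ Coloring λ φ → Proper S φ

      avoids : Fin n → ℕ → Coloring → Bool
      avoids v c φ = not (does (colour φ v ℕ.≟ c))

      avoids-intro : ∀ {v c φ} → colour φ v ≢ c → avoids v c φ ≡ true
      avoids-intro {v} {c} {φ} ≢c = cong not (dec-false (colour φ v ℕ.≟ c) ≢c)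

      avoids-elim : ∀ {v c φ} → avoids v c φ ≡ true → colour φ v ≢ c
      avoids-elim {v} {c} {φ} eq ≡c with trans (≡-sym eq) (cong not (dec-true (colour φ v ℕ.≟ c) ≡c))
      ... | ()

      takes : Fin n → Fin 4 → Coloring → Bool
      takes v i φ = does (φ v ≟ i)

      proper? : ∀ S φ → Dec (Proper S φ)
      proper? S φ = map′ (λ pr {u} {v} → pr u v) (λ pr u v → pr)
        (all? λ u → all? λ v → (u ∈ˢ? S) →-dec (v ∈ˢ? S) →-dec (adj G u v Bool.≟ true) →-dec
                               ¬? (colour φ u ℕ.≟ colour φ v))

      Assignment : List (Fin n) → Coloring → Set
      Assignment H ψ = Σ Coloring λ φ → ∀ {v} → v ∉ H → φ v ≡ ψ v

      reassign : ∀ {h H ψ} i → Assignment H (ψ [ h ≔ i ]) → Assignment (h ∷ H) ψ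
      reassign {h} {ψ = ψ} i (φ , agrees) = φ , λ v∉ → trans (agrees (v∉ ∘ there)) (update-≢ ψ h i (v∉ ∘ here))

      assignments : ∀ H ψ → List (Assignment H ψ)
      assignments []      ψ = [ ψ , (λ _ → refl) ]
      assignments (h ∷ H) ψ = concatMap (λ i → map (reassign i) (assignments H (ψ [ h ≔ i ]))) (allFin 4)

      length-assignments : ∀ H ψ → length (assignments H ψ) ≡ 4 ^ length H
      length-assignments []      ψ = refl
      length-assignments (h ∷ H) ψ = length-concatMap (λ i → map (reassign i) (assignments H (ψ [ h ≔ i ]))) (allFin 4)
        (λ i → trans (length-map (reassign i) (assignments H (ψ [ h ≔ i ]))) (length-assignments H (ψ [ h ≔ i ])))

      -- Completeness is up to pointwise equality of functions, so the events counted later come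
      -- with lemmas such as `avoids-resp`.
      assignments-complete : ∀ H ψ φ → (∀ {v} → v ∉ H → φ v ≡ ψ v) → Any (λ a → proj₁ a ≗ φ) (assignments H ψ)
      assignments-complete []      ψ φ agrees = here (λ v → ≡-sym (agrees (λ ())))
      assignments-complete (h ∷ H) ψ φ agrees = Any.concatMap⁺ (λ i → map (reassign i) (assignments H (ψ [ h ≔ i ])))
        (lose (∈-allFin (φ h)) (Any.map⁺ (assignments-complete H (ψ [ h ≔ φ h ]) φ agrees′)))
        where
        agrees′ : ∀ {v} → v ∉ H → φ v ≡ (ψ [ h ≔ φ h ]) v
        agrees′ {v} v∉ with v ≟ h
        ... | yes refl = refl
        ... | no v≢h   = agrees (λ { (here v≡h) → v≢h v≡h ; (there v∈) → v∉ v∈ })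

      module _ {S H ψ} (fallback : Extension S H ψ) where

        private
          repair : (a : Assignment H ψ) → Dec (Proper S (proj₁ a)) → Extension S H ψ
          repair (φ , agrees) (yes proper) = extension φ agrees proper
          repair _            (no _)       = fallback

        -- Improper assignments are replaced rather than discarded, so every block has the same
        -- size, as `frequent-bind` requires.
        extensions : List (Extension S H ψ)
        extensions = map (λ a → repair a (proper? S (proj₁ a))) (assignments H ψ)

        length-extensions : length extensions ≡ 4 ^ length H
        length-extensions = trans (length-map _ (assignments H ψ)) (length-assignments H ψ)

        extensions-complete : (e : Extension S H ψ) → Any (λ e′ → φ e′ ≗ φ e) extensions
        extensions-complete e = Any.map⁺ (Any.map (λ {a} same → repaired a (proper? S (proj₁ a)) same)
                                                  (assignments-complete H ψ (φ e) (agrees e)))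
          where
          repaired : ∀ a d → proj₁ a ≗ φ e → φ (repair a d) ≗ φ e
          repaired a (yes _) same = same
          repaired a (no ¬proper) same = contradiction
            (λ {u} {v} u∈ v∈ uv eq → proper e u∈ v∈ uv
              (trans (cong (lookup (L u)) (≡-sym (same u))) (trans eq (cong (lookup (L v)) (same v))))) ¬proper

      module _ (N : ℕ) (N-large : 4 ^ 5 ≤ N) where

        -- The exponents count the reduction steps relied upon. A vertex just put back avoids `c`
        -- within its own block; a demanded pair may need one avoidance in the smaller set as well;
        -- taking a colour may need a demanded pair to avoid it first. Events on older vertices
        -- persist without loss, so the constants do not grow with `S`.
        record Flexible (S : VertexSet) : Set where
          field
            sample    : List (ProperColoring S)
            inhabited : 1 ≤ length sample
            avoid₁    : ∀ {u} → u ∈ˢ S → ∀ c → Frequent N (avoids u c ∘ proj₁) sample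
            avoid₂    : ∀ {u v} → Demanded S u v → ∀ c →
                        Frequent (N * N) (λ x → avoids u c (proj₁ x) ∧ avoids v c (proj₁ x)) sample
            attain    : ∀ {v} → v ∈ˢ S → ∀ i → Frequent (N * (N * N)) (takes v i ∘ proj₁) sample

        private
          1≤N : 1 ≤ N
          1≤N = ≤-trans (s≤s z≤n) N-large

        empty-flexible : ∀ {S} → (∀ {v} → ¬ v ∈ˢ S) → Flexible S
        empty-flexible {S} empty = record
          { sample    = [ (λ _ → zero) , (λ u∈ → contradiction u∈ empty) ]
          ; inhabited = s≤s z≤n
          ; avoid₁    = λ u∈ → contradiction u∈ empty
          ; avoid₂    = λ { (_ , _ , _ , _ , u∈ , _) → contradiction (proj₁ (nbrs-elim {S} u∈)) empty }
          ; attain    = λ v∈ → contradiction v∈ empty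
          }

        module _ {S : VertexSet} (red : Reducible S) where

          open Reducible red

          private
            R : VertexSet
            R = S ∖ H

            Ext : Coloring → Set
            Ext = Extension S H

            -- By `few` at most two colours are blocked, so one more can be excluded. With empty `F`
            -- this supplies the fallback extension of `block`.
            avoiding-at : ∀ {u ψ} → u ∈ H → Proper R ψ → ∀ F → length F ≤ 1 → Σ (Ext ψ) λ e → colour (φ e) u ∉ F
            avoiding-at {u} {ψ} u∈ proper F |F|≤1 =
              let (i , allowed , i∉) = allowed-avoiding R u ψ F (+-mono-≤ (few u∈) |F|≤1)
                  (e , eq)           = single u∈ proper i allowed
              in e , subst (λ j → lookup (L u) j ∉ F) (≡-sym eq) i∉

            forget : ∀ {ψ} → Ext ψ → ProperColoring S
            forget e = φ e , λ {u} {v} → proper e {u} {v}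

            block : (x : ProperColoring R) → List (Ext (proj₁ x))
            block (ψ , proper) = extensions (proj₁ (avoiding-at (proj₂ nonempty) proper [] z≤n))

            grow : ProperColoring R → List (ProperColoring S)
            grow x = map forget (block x)

            length-grow : ∀ x → length (grow x) ≡ 4 ^ length H
            length-grow (ψ , pr) = trans (length-map _ (block (ψ , pr)))
              (length-extensions (proj₁ (avoiding-at (proj₂ nonempty) pr [] z≤n)))

            grow-hit : ∀ x {q : Coloring → Bool} → (∀ {φ φ′} → φ ≗ φ′ → q φ ≡ true → q φ′ ≡ true) → (e : Ext (proj₁ x)) → q (φ e) ≡ true →
                       1 ≤ count (q ∘ proj₁) (grow x)
            grow-hit (ψ , pr) resp e qe = count-any (Any.map⁺ (Any.map (λ same → resp (λ v → ≡-sym (same v)) qe)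
              (extensions-complete (proj₁ (avoiding-at (proj₂ nonempty) pr [] z≤n)) e)))

            grow-keep : ∀ x {q : Coloring → Bool} → (∀ (e : Ext (proj₁ x)) → q (φ e) ≡ true) → 4 ^ length H ≤ count (q ∘ proj₁) (grow x)
            grow-keep x {q} all = ≤-reflexive (trans (≡-sym (length-grow x)) (≡-sym
              (trans (∑-map (b2n ∘ q ∘ proj₁) forget (block x))
                     (trans (count-all (block x) all) (≡-sym (length-map _ (block x)))))))

            small : 4 ^ length H ≤ N
            small = ≤-trans (^-monoʳ-≤ 4 bounded) N-large

            positive : 1 ≤ 4 ^ length H
            positive = m^n>0 4 (length H)

            avoids-resp : ∀ u c {φ φ′} → φ ≗ φ′ → avoids u c φ ≡ true → avoids u c φ′ ≡ true
            avoids-resp u c same = subst (λ i → not (does (lookup (L u) i ℕ.≟ c)) ≡ true) (same u)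

            both-resp : ∀ u v c {φ φ′} → φ ≗ φ′ → avoids u c φ ∧ avoids v c φ ≡ true → avoids u c φ′ ∧ avoids v c φ′ ≡ true
            both-resp u v c {φ} {φ′} same = subst (λ b → b ≡ true)
              (cong₂ (λ i j → not (does (lookup (L u) i ℕ.≟ c)) ∧ not (does (lookup (L v) j ℕ.≟ c))) (same u) (same v))

            takes-resp : ∀ v i {φ φ′} → φ ≗ φ′ → takes v i φ ≡ true → takes v i φ′ ≡ true
            takes-resp v i same = subst (λ j → does (j ≟ i) ≡ true) (same v)

            ∧-elim : ∀ {a b} → a ∧ b ≡ true → a ≡ true × b ≡ true
            ∧-elim {true} {true} _ = refl , refl

            takes-elim : ∀ {v i φ} → φ v ≡ i → takes v i φ ≡ true
            takes-elim {v} {i} {φ} eq = dec-true (φ v ≟ i) eq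

            R-or-H : ∀ {v} → v ∈ˢ S → v ∈ˢ R ⊎ v ∈ H
            R-or-H {v} v∈S = locate (v ∈? H)
              where
              locate : Dec (v ∈ H) → v ∈ˢ R ⊎ v ∈ H
              locate (yes v∈H) = inj₂ v∈H
              locate (no v∉H)  = inj₁ (∖-intro {S = S} v∈S v∉H)

            outside : ∀ {v ψ} → v ∈ˢ R → (e : Ext ψ) → φ e v ≡ ψ v
            outside v∈R e = agrees e (proj₂ (∖-elim {S = S} v∈R))

          extend-flexible : Flexible R → Flexible S
          extend-flexible flex = record
            { sample    = sample′
            ; inhabited = ≤-trans (*-mono-≤ F.inhabited positive) (≤-reflexive (≡-sym (length-concatMap grow F.sample length-grow)))
            ; avoid₁    = λ {u} u∈S c → avoid-one (R-or-H u∈S) c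
            ; avoid₂    = λ {u} {v} dem c → avoid-two dem (R-or-H (in-S (proj₁ (ends dem)))) (R-or-H (in-S (proj₂ (ends dem)))) c
            ; attain    = λ {v} v∈S i → attain′ (R-or-H v∈S) i
            }
            where
            module F = Flexible flex
            sample′ : List (ProperColoring S)
            sample′ = concatMap grow F.sample

            in-S : ∀ {u} → (∃ λ w → u ∈ nbrs S w) → u ∈ˢ S
            in-S (w , u∈) = proj₁ (nbrs-elim {S} u∈)
            ends : ∀ {u v} → Demanded S u v → (∃ λ w → u ∈ nbrs S w) × (∃ λ w → v ∈ nbrs S w)
            ends (w , _ , _ , _ , u∈ , v∈) = (w , u∈) , (w , v∈)

            -- One suitable extension above each good colouring is enough: it is at least one entry
            -- of a block of at most `N`.
            hit : ∀ {K p q} → Frequent K (p ∘ proj₁) F.sample → (∀ {φ φ′} → φ ≗ φ′ → q φ ≡ true → q φ′ ≡ true) →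
                  (∀ {ψ} → Proper R ψ → p ψ ≡ true → Σ (Ext ψ) λ e → q (φ e) ≡ true) → Frequent (N * K) (q ∘ proj₁) sample′
            hit freq resp found = frequent-hit grow length-grow F.sample small freq
              (λ x px → let (e , qe) = found (proj₂ x) px in grow-hit x resp e qe)

            always : ∀ {q} → (∀ {φ φ′} → φ ≗ φ′ → q φ ≡ true → q φ′ ≡ true) →
                     (∀ {ψ} → Proper R ψ → Σ (Ext ψ) λ e → q (φ e) ≡ true) → Frequent N (q ∘ proj₁) sample′
            always resp found = subst (λ K → Frequent K _ sample′) (*-identityʳ N)
              (hit {p = λ _ → true} (frequent-always F.sample) resp (λ pr _ → found pr))

            keep : ∀ {K p q} → Frequent K (p ∘ proj₁) F.sample → (∀ {ψ} → p ψ ≡ true → ∀ (e : Ext ψ) → q (φ e) ≡ true) →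
                   Frequent K (q ∘ proj₁) sample′
            keep freq kept = frequent-keep grow length-grow F.sample positive freq (λ x px → grow-keep x (kept px))

            avoid-one : ∀ {u} → u ∈ˢ R ⊎ u ∈ H → ∀ c → Frequent N (avoids u c ∘ proj₁) sample′
            avoid-one {u} (inj₁ u∈R) c = keep {p = avoids u c} (F.avoid₁ u∈R c)
              (λ av e → subst (λ i → not (does (lookup (L u) i ℕ.≟ c)) ≡ true) (≡-sym (outside u∈R e)) av)
            avoid-one {u} (inj₂ u∈H) c = always (avoids-resp u c)
              (λ pr → let (e , ∉c) = avoiding-at u∈H pr [ c ] ≤-refl in e , avoids-intro {u} {c} {φ e} (∉c ∘ here))

            -- The vertex `w` behind the demand has no neighbours in `S` besides `u` and `v`, and
            -- both survive, so its degree into `R` is still two.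
            shrink : ∀ {u v} → Demanded S u v → u ∈ˢ R → v ∈ˢ R → Demanded R u v
            shrink {u} {v} (w , w∉ , d₂ , u≢v , u∈ , v∈) u∈R v∈R = w , w∉R ,
              ≤-antisym (≤-trans (deg-mono {S} {R} {w} (λ z∈ → proj₁ (∖-elim {S = S} {H} z∈))) (≤-reflexive d₂))
                        (length-⊆ {xs = u ∷ v ∷ []} ((u≢v ∷ []) ∷ [] ∷ []) (λ { (here refl) → u∈′ ; (there (here refl)) → v∈′ }))
              , u≢v , u∈′ , v∈′
              where
              u∈′ : u ∈ nbrs R w
              u∈′ = nbrs-intro {R} u∈R (proj₂ (nbrs-elim {S} u∈))
              v∈′ : v ∈ nbrs R w
              v∈′ = nbrs-intro {R} v∈R (proj₂ (nbrs-elim {S} v∈))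
              w∉R : R w ≡ false
              w∉R = cong (_∧ not ⌊ w ∈? H ⌋) w∉

            both : ∀ {u v c φ} → avoids u c φ ≡ true → avoids v c φ ≡ true → avoids u c φ ∧ avoids v c φ ≡ true
            both au av = cong₂ _∧_ au av

            pass : ∀ {u c ψ} → u ∈ˢ R → avoids u c ψ ≡ true → (e : Ext ψ) → avoids u c (φ e) ≡ true
            pass {u} {c} u∈R au e = subst (λ i → not (does (lookup (L u) i ℕ.≟ c)) ≡ true) (≡-sym (outside u∈R e)) au

            avoid-two : ∀ {u v} → Demanded S u v → u ∈ˢ R ⊎ u ∈ H → v ∈ˢ R ⊎ v ∈ H → ∀ c →
                        Frequent (N * N) (λ x → avoids u c (proj₁ x) ∧ avoids v c (proj₁ x)) sample′
            avoid-two {u} {v} dem (inj₁ u∈R) (inj₁ v∈R) c = keep {p = λ ψ → avoids u c ψ ∧ avoids v c ψ} {q = λ ψ → avoids u c ψ ∧ avoids v c ψ}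
              (F.avoid₂ (shrink dem u∈R v∈R) c)
              (λ {ψ} av e → let (au , av′) = ∧-elim {avoids u c ψ} av in both {u} {v} {c} {φ e} (pass {u} {c} u∈R au e) (pass {v} {c} v∈R av′ e))
            avoid-two {u} {v} dem (inj₁ u∈R) (inj₂ v∈H) c = hit {p = avoids u c} {q = λ ψ → avoids u c ψ ∧ avoids v c ψ}
              (F.avoid₁ u∈R c) (both-resp u v c)
              (λ pr au → let (e , ∉c) = avoiding-at v∈H pr [ c ] ≤-refl in
                         e , both {u} {v} {c} {φ e} (pass {u} {c} u∈R au e) (avoids-intro {v} {c} {φ e} (∉c ∘ here)))
            avoid-two {u} {v} dem (inj₂ u∈H) (inj₁ v∈R) c = hit {p = avoids v c} {q = λ ψ → avoids u c ψ ∧ avoids v c ψ}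
              (F.avoid₁ v∈R c) (both-resp u v c)
              (λ pr av → let (e , ∉c) = avoiding-at u∈H pr [ c ] ≤-refl in
                         e , both {u} {v} {c} {φ e} (avoids-intro {u} {c} {φ e} (∉c ∘ here)) (pass {v} {c} v∈R av e))
            avoid-two {u} {v} dem (inj₂ u∈H) (inj₂ v∈H) c = by-pair (pair u∈H v∈H dem c)
              where
              q : Coloring → Bool
              q ψ = avoids u c ψ ∧ avoids v c ψ
              good : ∀ {ψ} → Avoiding S H ψ u v c → Σ (Ext ψ) λ e → q (φ e) ≡ true
              good (e , u≢c , v≢c) = e , both {u} {v} {c} {φ e} (avoids-intro {u} {c} {φ e} u≢c) (avoids-intro {v} {c} {φ e} v≢c)
              by-pair : ((∀ {ψ} → Proper R ψ → Avoiding S H ψ u v c) ⊎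
                         (∃ λ z → ∃ λ g → z ∈ˢ R × (∀ {ψ} → Proper R ψ → colour ψ z ≢ g → Avoiding S H ψ u v c))) →
                        Frequent (N * N) (q ∘ proj₁) sample′
              by-pair (inj₁ avoiding) = frequent-mono {K = N} (≤-trans (≤-reflexive (≡-sym (*-identityʳ N))) (*-monoʳ-≤ N 1≤N))
                (always {q = q} (both-resp u v c) (λ pr → good (avoiding pr)))
              -- The colour of `z` is settled before `H` is coloured, so `avoid₁` for `R` provides
              -- the extra condition at the price of one factor `N`.
              by-pair (inj₂ (z , g , z∈R , avoiding)) = hit {p = avoids z g} {q = q} (F.avoid₁ z∈R g) (both-resp u v c)
                (λ {ψ} pr az → good (avoiding pr (avoids-elim {z} {g} {ψ} az)))

            -- A vertex of `H` can take any colour that its at most two neighbours in `R` avoid; the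
            -- frequency of that avoidance comes from the smaller set.
            attain′ : ∀ {v} → v ∈ˢ R ⊎ v ∈ H → ∀ i → Frequent (N * (N * N)) (takes v i ∘ proj₁) sample′
            attain′ {v} (inj₁ v∈R) i = keep {p = takes v i} (F.attain v∈R i)
              (λ tk e → subst (λ j → does (j ≟ i) ≡ true) (≡-sym (outside v∈R e)) tk)
            attain′ {v} (inj₂ v∈H) i = by-nbrs (nbrs R v) refl (few v∈H)
              where
              c : ℕ
              c = lookup (L v) i
              realise : ∀ {ψ} → Proper R ψ → (∀ {z} → z ∈ nbrs R v → colour ψ z ≢ c) → Σ (Ext ψ) λ e → takes v i (φ e) ≡ true
              realise pr allowed = let (e , eq) = single v∈H pr i (λ z∈ vz → allowed (nbrs-intro {R} z∈ vz)) in
                                e , takes-elim {v} {i} {φ e} eq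
              by-nbrs : ∀ zs → nbrs R v ≡ zs → length zs ≤ 2 → Frequent (N * (N * N)) (takes v i ∘ proj₁) sample′
              by-nbrs [] eq _ = frequent-mono {K = N} (≤-trans (≤-reflexive (≡-sym (*-identityʳ N))) (*-monoʳ-≤ N (*-mono-≤ 1≤N 1≤N)))
                (always {q = takes v i} (takes-resp v i) (λ pr → realise pr (λ z∈ → contradiction (subst (_ ∈_) eq z∈) λ ())))
              by-nbrs (y ∷ []) eq _ = frequent-mono {K = N * N} (*-monoʳ-≤ N (≤-trans (≤-reflexive (≡-sym (*-identityʳ N))) (*-monoʳ-≤ N 1≤N)))
                (hit {p = avoids y c} {q = takes v i} (F.avoid₁ (proj₁ (nbrs-elim {R} (subst (y ∈_) (≡-sym eq) (here refl)))) c) (takes-resp v i)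
                  (λ {ψ} pr ay → realise pr (λ z∈ → only {ψ} (avoids-elim {y} {c} {ψ} ay) (subst (_ ∈_) eq z∈))))
                where
                only : ∀ {ψ} → colour ψ y ≢ c → ∀ {z} → z ∈ [ y ] → colour ψ z ≢ c
                only y≢c (here refl) = y≢c
              by-nbrs (x ∷ y ∷ []) eq _ = hit {p = λ ψ → avoids x c ψ ∧ avoids y c ψ} {q = takes v i} (F.avoid₂ demanded c) (takes-resp v i)
                (λ {ψ} pr axy → let (ax , ay) = ∧-elim {avoids x c ψ} axy in
                  realise pr (λ z∈ → only {ψ} (avoids-elim {x} {c} {ψ} ax) (avoids-elim {y} {c} {ψ} ay) (subst (_ ∈_) eq z∈)))
                where
                only : ∀ {ψ} → colour ψ x ≢ c → colour ψ y ≢ c → ∀ {z} → z ∈ x ∷ y ∷ [] → colour ψ z ≢ c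
                only x≢c y≢c (here refl)         = x≢c
                only x≢c y≢c (there (here refl)) = y≢c
                -- This is what demands are for: `v` lies outside `R`, and `x`, `y` are all its
                -- neighbours there.
                demanded : Demanded R x y
                demanded = v , ∖-removed S v∈H , cong length eq , x≢y , subst (x ∈_) (≡-sym eq) (here refl) , subst (y ∈_) (≡-sym eq) (there (here refl))
                  where
                  x≢y : x ≢ y
                  x≢y x≡y with subst (AllPairs _≢_) eq (nbrs-unique R v)
                  ... | (x≢y′ ∷ []) ∷ _ = x≢y′ x≡y
              by-nbrs (_ ∷ _ ∷ _ ∷ _) _ (s≤s (s≤s ()))

        -- The induction runs on an upper bound for the size, because a reduction may remove several
        -- vertices at once.
        flexible : MadLt11/3 G → ∀ S → Flexible S
        flexible mad S = by-size (length (members S)) S ≤-refl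
          where
          by-size : ∀ k S → length (members S) ≤ k → Flexible S
          by-size k S size≤ with any? (_∈ˢ? S)
          ... | no none = empty-flexible (λ {v} v∈ → none (v , v∈))
          by-size zero S size≤ | yes (v , v∈) = contradiction
            (≤-trans (length-⊆ {xs = [ v ]} ([] ∷ []) (λ { (here refl) → members-intro {S} v∈ })) size≤) λ ()
          by-size (suc k) S size≤ | yes (v , v∈) = extend-flexible red (by-size k (S ∖ H) (≤-pred (≤-trans smaller size≤)))
            where
            red : Reducible S
            red = reducible-exists S mad v∈
            open Reducible red
            h = proj₁ nonempty
            smaller : suc (length (members (S ∖ H))) ≤ length (members S)
            smaller = length-⊆ {xs = h ∷ members (S ∖ H)}
              (All.tabulate (λ { w∈ refl → proj₂ (∖-elim {S = S} (members-elim {S ∖ H} w∈)) (proj₂ nonempty) }) ∷ members-unique (S ∖ H))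
              (λ { (here refl) → members-intro {S} (inside (proj₂ nonempty))
                 ; (there w∈) → members-intro {S} (proj₁ (∖-elim {S = S} {H} (members-elim {S ∖ H} w∈))) })

-- Averaging over the multiset with rational weights.

module _ where

  open import Data.Rational using (1ℚ; 0ℚ; ℚ; _+_; _*_; _≤_; _<_; 1/_; positive)
  open import Algebra.Properties.CommutativeMonoid.Mult ℚ.+-0-commutativeMonoid using (×-homo-1; ×-homo-+; ×-assocˡ; ×-distrib-+) renaming (_×_ to _·_)
  open import Algebra.Properties.Semiring.Mult (Algebra.Bundles.Ring.semiring ℚ.+-*-ring) using (×-assoc-*)
  open import Algebra.Properties.CommutativeSemigroup (Algebra.Bundles.CommutativeMonoid.commutativeSemigroup ℚ.+-0-commutativeMonoid) using (interchange)

  module _ {A : Set} where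

    ∑ℚ : (A → ℚ) → List A → ℚ
    ∑ℚ f xs = foldr _+_ 0ℚ (map f xs)

    ∑ℚ-mono : ∀ {f g : A → ℚ} xs → (∀ x → f x ≤ g x) → ∑ℚ f xs ≤ ∑ℚ g xs
    ∑ℚ-mono []       f≤g = ℚ.≤-refl
    ∑ℚ-mono (x ∷ xs) f≤g = ℚ.+-mono-≤ (f≤g x) (∑ℚ-mono xs f≤g)

    ∑ℚ-cong : ∀ {f g : A → ℚ} xs → (∀ x → f x ≡ g x) → ∑ℚ f xs ≡ ∑ℚ g xs
    ∑ℚ-cong []       f≡g = refl
    ∑ℚ-cong (x ∷ xs) f≡g = cong₂ _+_ (f≡g x) (∑ℚ-cong xs f≡g)

    ∑ℚ-+ : ∀ (f g : A → ℚ) xs → ∑ℚ (λ x → f x + g x) xs ≡ ∑ℚ f xs + ∑ℚ g xs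
    ∑ℚ-+ f g []       = refl
    ∑ℚ-+ f g (x ∷ xs) =
      trans (cong (f x + g x +_) (∑ℚ-+ f g xs)) (interchange (f x) (g x) (∑ℚ f xs) (∑ℚ g xs))

    ∑ℚ-0 : ∀ (xs : List A) → ∑ℚ (λ _ → 0ℚ) xs ≡ 0ℚ
    ∑ℚ-0 []       = refl
    ∑ℚ-0 (x ∷ xs) = trans (ℚ.+-identityˡ _) (∑ℚ-0 xs)

    ∑ℚ-· : ∀ k (f : A → ℚ) xs → ∑ℚ (λ x → k · f x) xs ≡ k · ∑ℚ f xs
    ∑ℚ-· k f []       = ≡-sym (zero-· k)
      where
      zero-· : ∀ k → k · 0ℚ ≡ 0ℚ
      zero-· zero    = refl
      zero-· (suc k) = trans (ℚ.+-identityˡ _) (zero-· k)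
    ∑ℚ-· k f (x ∷ xs) = trans (cong (k · f x +_) (∑ℚ-· k f xs)) (≡-sym (×-distrib-+ (f x) (∑ℚ f xs) k))

    ∑ℚ-multiples : ∀ (k : A → ℕ) q xs → ∑ℚ (λ x → k x · q) xs ≡ ∑ k xs · q
    ∑ℚ-multiples k q []       = refl
    ∑ℚ-multiples k q (x ∷ xs) = trans (cong (k x · q +_) (∑ℚ-multiples k q xs)) (≡-sym (×-homo-+ q (k x) (∑ k xs)))

    ∑ℚ-const : ∀ q (xs : List A) → ∑ℚ (λ _ → q) xs ≡ length xs · q
    ∑ℚ-const q []       = refl
    ∑ℚ-const q (x ∷ xs) = cong (q +_) (∑ℚ-const q xs)

    -- If the head lies below `t`, the tail must still reach its own share, so the search can
    -- continue there.
    ∃-above-average : ∀ {g : A → ℚ} {t} xs → 1 ℕ.≤ length xs → ∑ℚ (λ _ → t) xs ≤ ∑ℚ g xs → ∃ λ x → t ≤ g x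
    ∃-above-average {g} {t} (x ∷ xs) _ = among x xs
      where
      among : ∀ x xs → ∑ℚ (λ _ → t) (x ∷ xs) ≤ ∑ℚ g (x ∷ xs) → ∃ λ x → t ≤ g x
      among x []       average = x , subst₂ _≤_ (ℚ.+-identityʳ t) (ℚ.+-identityʳ (g x)) average
      among x (y ∷ ys) average with t ℚ.≤? g x
      ... | yes t≤ = x , t≤
      ... | no t≰  = among y ys
        (ℚ.≮⇒≥ λ below → ℚ.<-irrefl refl (ℚ.<-≤-trans (ℚ.+-mono-< (ℚ.≰⇒> t≰) below) average))

  ∑ℚ-swap : ∀ {A B : Set} (f : A → B → ℚ) xs ys →
            ∑ℚ (λ x → ∑ℚ (f x) ys) xs ≡ ∑ℚ (λ y → ∑ℚ (λ x → f x y) xs) ys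
  ∑ℚ-swap f []       ys = ≡-sym (∑ℚ-0 ys)
  ∑ℚ-swap f (x ∷ xs) ys =
    trans (cong (∑ℚ (f x) ys +_) (∑ℚ-swap f xs ys)) (≡-sym (∑ℚ-+ (f x) (λ y → ∑ℚ (λ x → f x y) xs) ys))

  ·-mono : ∀ {j k q} → 0ℚ ≤ q → j ℕ.≤ k → j · q ≤ k · q
  ·-mono {k = zero}      0≤q z≤n     = ℚ.≤-refl
  ·-mono {k = suc k} {q} 0≤q z≤n     = subst (_≤ q + k · q) (ℚ.+-identityˡ 0ℚ) (ℚ.+-mono-≤ 0≤q (·-mono {k = k} 0≤q z≤n))
  ·-mono {q = q}         0≤q (s≤s p) = ℚ.+-mono-≤ (ℚ.≤-refl {q}) (·-mono 0≤q p)

  indicator-sum : ∀ (q : Fin 4 → ℚ) j → ∑ℚ (λ i → b2n (does (j ≟ i)) · q i) (allFin 4) ≡ q j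
  indicator-sum q j = by-index j
    where
    drop : ∀ {x y} → x ≡ y → 0ℚ + x ≡ y
    drop eq = trans (ℚ.+-identityˡ _) eq
    last : ∀ {x y} → x ≡ 0ℚ → y + 0ℚ + x ≡ y
    last {y = y} refl = trans (ℚ.+-identityʳ _) (ℚ.+-identityʳ y)
    by-index : ∀ j → ∑ℚ (λ i → b2n (does (j ≟ i)) · q i) (allFin 4) ≡ q j
    by-index zero                   = last refl
    by-index (suc zero)             = drop (last refl)
    by-index (suc (suc zero))       = drop (drop (last refl))
    by-index (suc (suc (suc zero))) = drop (drop (drop (last refl)))

  module _ {A : Set} {n : ℕ} (colouring : A → Fin n → Fin 4) (xs : List A) (inhabited : 1 ℕ.≤ length xs) (K : ℕ)
           (frequent : ∀ v i → length xs ℕ.≤ K ℕ.* ∑ (λ x → b2n (does (colouring x v ≟ i))) xs)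
           (w : Fin n → Fin 4 → ℚ) (w≥0 : ∀ v i → 0ℚ ≤ w v i) where

    private
      reorder : ∀ (f : A → Fin n → Fin 4 → ℚ) →
                ∑ℚ (λ x → ∑ℚ (λ v → ∑ℚ (f x v) (allFin 4)) (allFin n)) xs ≡
                ∑ℚ (λ v → ∑ℚ (λ i → ∑ℚ (λ x → f x v i) xs) (allFin 4)) (allFin n)
      reorder f = trans (∑ℚ-swap (λ x v → ∑ℚ (f x v) (allFin 4)) xs (allFin n))
                        (∑ℚ-cong (allFin n) (λ v → ∑ℚ-swap (λ x i → f x v i) xs (allFin 4)))

      share : A → Fin n → Fin 4 → ℚ
      share x v i = K · (b2n (does (colouring x v ≟ i)) · w v i)

      pointwise : ∀ v i → ∑ℚ (λ _ → w v i) xs ≤ ∑ℚ (λ x → share x v i) xs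
      pointwise v i = begin
        ∑ℚ (λ _ → w v i) xs     ≡⟨ ∑ℚ-const (w v i) xs ⟩
        length xs · w v i       ≤⟨ ·-mono (w≥0 v i) (frequent v i) ⟩
        (K ℕ.* hits) · w v i    ≡⟨ ×-assocˡ (w v i) K hits ⟨
        K · (hits · w v i)      ≡⟨ cong (K ·_) (∑ℚ-multiples (λ x → b2n (does (colouring x v ≟ i))) (w v i) xs) ⟨
        K · ∑ℚ (λ x → b2n (does (colouring x v ≟ i)) · w v i) xs
                                ≡⟨ ∑ℚ-· K (λ x → b2n (does (colouring x v ≟ i)) · w v i) xs ⟨
        ∑ℚ (λ x → share x v i) xs ∎
        where
        open ℚ.≤-Reasoning
        hits = ∑ (λ x → b2n (does (colouring x v ≟ i))) xs

      share-sum : ∀ x → ∑ℚ (λ v → ∑ℚ (share x v) (allFin 4)) (allFin n) ≡ K · gainedWeight w (colouring x)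
      share-sum x = trans
        (∑ℚ-cong (allFin n) (λ v → trans (∑ℚ-· K (λ i → b2n (does (colouring x v ≟ i)) · w v i) (allFin 4))
                                         (cong (K ·_) (indicator-sum (w v) (colouring x v)))))
        (∑ℚ-· K (λ v → w v (colouring x v)) (allFin n))

    -- Double counting: every pair of a vertex and a list position is realised in a fraction 1/`K`
    -- of the multiset, so `K` times the gained weight is on average at least the total weight, and
    -- some member reaches the average.
    ∃-heavy : ∃ λ x → totalWeight w ≤ K · gainedWeight w (colouring x)
    ∃-heavy = ∃-above-average xs inhabited (begin
      ∑ℚ (λ _ → totalWeight w) xs                                            ≡⟨ reorder (λ _ v i → w v i) ⟩
      ∑ℚ (λ v → ∑ℚ (λ i → ∑ℚ (λ _ → w v i) xs) (allFin 4)) (allFin n)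
        ≤⟨ ∑ℚ-mono (allFin n) (λ v → ∑ℚ-mono (allFin 4) (λ i → pointwise v i)) ⟩
      ∑ℚ (λ v → ∑ℚ (λ i → ∑ℚ (λ x → share x v i) xs) (allFin 4)) (allFin n)  ≡⟨ reorder share ⟨
      ∑ℚ (λ x → ∑ℚ (λ v → ∑ℚ (share x v) (allFin 4)) (allFin n)) xs          ≡⟨ ∑ℚ-cong xs share-sum ⟩
      ∑ℚ (λ x → K · gainedWeight w (colouring x)) xs                         ∎)
      where open ℚ.≤-Reasoning

  -- The witness is the inverse of `K · 1ℚ`; rewriting `K · q` as a product with this rational lets
  -- the two cancel.
  reciprocal : ∀ K → 1 ℕ.≤ K → ∃ λ ε → ∃ λ (_ : 0ℚ < ε) → ∀ {p q} → p ≤ K · q → ε * p ≤ q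
  reciprocal K 1≤K = 1/ k , ℚ.positive⁻¹ (1/ k) , λ {p} {q} p≤ → begin
      1/ k * p           ≤⟨ ℚ.*-monoˡ-≤-nonNeg (1/ k) p≤ ⟩
      1/ k * (K · q)     ≡⟨ cong (λ r → 1/ k * (K · r)) (ℚ.*-identityˡ q) ⟨
      1/ k * (K · (1ℚ * q)) ≡⟨ cong (1/ k *_) (×-assoc-* K 1ℚ q) ⟨
      1/ k * (k * q)     ≡⟨ ℚ.*-assoc (1/ k) k q ⟨
      1/ k * k * q       ≡⟨ cong (_* q) (ℚ.*-inverseˡ k) ⟩
      1ℚ * q             ≡⟨ ℚ.*-identityˡ q ⟩
      q                  ∎
    where
    open ℚ.≤-Reasoning
    k : ℚ
    k = K · 1ℚ
    instance
      k-positive : ℚ.Positive k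
      k-positive = positive (ℚ.<-≤-trans (ℚ.positive⁻¹ 1ℚ) (subst (_≤ k) (×-homo-1 1ℚ) (·-mono (ℚ.nonNegative⁻¹ 1ℚ) 1≤K)))
      k-nonZero : ℚ.NonZero k
      k-nonZero = ℚ.pos⇒nonZero k
      1/k-positive : ℚ.Positive (1/ k)
      1/k-positive = ℚ.1/pos⇒pos k
      1/k-nonNegative : ℚ.NonNegative (1/ k)
      1/k-nonNegative = ℚ.pos⇒nonNeg (1/ k)

-- Abstract, since evaluating the unary number N³ exhausts memory.
abstract
  N : ℕ
  N = 4 ℕ.^ 5

  N-large : 4 ℕ.^ 5 ℕ.≤ N
  N-large = ℕ.≤-refl

open import Data.Rational using (ℚ; 0ℚ; _<_; _≤_; _*_)

theorem1p2 : Σ ℚ λ ε → (0ℚ < ε) ×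
    (∀ (n : ℕ) (G : Graph n) → MadLt11/3 G →
    ∀ (L : Fin n → Vec ℕ 4) → IsKAssignment L →
    ∀ (w : Fin n → Fin 4 → ℚ) → (∀ v i → 0ℚ ≤ w v i) →
    ∃ λ (φ : Fin n → Fin 4) → IsProperLColoring G L φ × (ε * totalWeight w ≤ gainedWeight w φ))
theorem1p2 = ε , ε>0 , λ n G mad L L-distinct w w≥0 →
  -- Here `S` is the whole vertex set, so no vertex is outside to create a demand, and `attain`
  -- covers every vertex and list entry with the constant `K`.
  let open Flexible (flexible G L L-distinct N N-large mad (λ _ → true))
      ((φ , proper) , heavy) = ∃-heavy proj₁ sample inhabited K (λ v i → Frequent.length≤ (attain refl i)) w w≥0
  in φ , (λ u v uv → proper refl refl uv) , scale heavy
  where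
  K : ℕ
  K = N ℕ.* (N ℕ.* N)
  1≤N : 1 ℕ.≤ N
  1≤N = ℕ.≤-trans (s≤s z≤n) N-large
  constant = reciprocal K (ℕ.*-mono-≤ 1≤N (ℕ.*-mono-≤ 1≤N 1≤N))
  ε     = proj₁ constant
  ε>0   = proj₁ (proj₂ constant)
  scale = proj₂ (proj₂ constant)
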